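{- Let $n\ge 1$ be an integer. Uniformly over all prime powers $q$, all nonzero matrices $U\in \mathrm{M}_n(\mathbb{F}_q)$ and all nontrivial additive characters $\lambda$ of $\mathbb{F}_q$, we have $$G_{\mathrm{GL}_n(\mathbb{F}_q)}(U,\lambda)=O(q^{n^2-n}),$$ where the implied constant depends only on $n$. That is, for each $n\ge1$ there is a constant $C_n>0$ such that $|G_{\mathrm{GL}_n(\mathbb{F}_q)}(U,\lambda)|\le C_n\, q^{n^2-n}$ for all such $q$, $U$, $\lambda$.
   Context: $\mathrm{M}_n(\mathbb{F}_q)$ is the set of $n\times n$ matrices over $\mathbb{F}_q$. For $U=(u_{ij}),V=(v_{ij})\in \mathrm{M}_n(\mathbb{F}_q)$, put $U\cdot V=\sum_{1\le i,j\le n}u_{ij}v_{ij}\in \mathbb{F}_q$ (entrywise product summed, not matrix multiplication). An additive character is a homomorphism $(\mathbb{F}_q,+)\to\mathbb{C}^*$. Define $$G_{\mathrm{GL}_n(\mathbb{F}_q)}(U,\lambda)=\sum_{X\in \mathrm{GL}_n(\mathbb{F}_q)}\lambda(U\cdot X).$$ -}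

module Defs where

open import Algebra.Bundles using (CommutativeRing)
open import Algebra.Structures using (IsCommutativeRing)
import Algebra.Definitions.RawMonoid as RawMonoidDefs
open import Data.Fin using (Fin)
import Data.Fin.Properties as Fin
open import Data.Integer as ℤ using (+_)
import Data.Integer.Properties as ℤ
open import Data.List using (List; []; _∷_; allFin; cartesianProductWith; filter; foldr; map)
open import Data.List.Membership.Propositional using (_∈_; lose; find)
open import Data.List.Membership.Propositional.Properties
  using (∈-cartesianProductWith⁺; ∈-map⁺; ∈-allFin)
open import Data.List.Relation.Unary.Any using (any?; here)
open import Data.Nat as ℕ using (ℕ; zero; suc)
import Data.Nat.DivMod as ℕ
import Data.Nat.Properties as ℕ
open import Data.Product using (∃; _×_; _,_)
open import Data.Rational as ℚ using (ℚ; mkℚ; 0ℚ; 1ℚ; ½; ↥_; ↧ₙ_)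
import Data.Rational.Properties as ℚ
import Data.Rational.Unnormalised as ℚᵘ
import Data.Rational.Unnormalised.Properties as ℚᵘ
open import Data.Rational.Solver using (module +-*-Solver)
open import Data.Sum using (inj₁; inj₂)
open import Data.Vec using (Vec; []; _∷_; lookup; tabulate; replicate)
import Data.Vec.Properties as Vec
open import Function.Bundles using (_↔_; Inverse; mk↣)
open import Level using (0ℓ)
open import Relation.Binary using (DecidableEquality)
open import Relation.Binary.PropositionalEquality
open import Relation.Nullary using (¬_; Dec; yes; no; contradiction)
open import Relation.Nullary.Decidable using (map′; _×-dec_)

IsCauchy : (ℕ → ℚ) → Set
IsCauchy x = ∀ ε → 0ℚ ℚ.< ε →
  ∃ λ N → ∀ m n → N ℕ.≤ m → N ℕ.≤ n → ℚ.∣ x m ℚ.- x n ∣ ℚ.< ε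

-- A real number is a Cauchy sequence of rationals; there being no quotients,
-- equality of reals is the relation ≈ℝ, not ≡.
record ℝ : Set where
  constructor mkℝ
  field
    seq    : ℕ → ℚ
    cauchy : IsCauchy seq

open ℝ public

infix 4 _≈ℝ_ _≤ℝ_ _<ℝ_

_≈ℝ_ : ℝ → ℝ → Set
x ≈ℝ y = ∀ ε → 0ℚ ℚ.< ε →
  ∃ λ N → ∀ n → N ℕ.≤ n → ℚ.∣ seq x n ℚ.- seq y n ∣ ℚ.< ε

_≤ℝ_ : ℝ → ℝ → Set
x ≤ℝ y = ∀ ε → 0ℚ ℚ.< ε →
  ∃ λ N → ∀ n → N ℕ.≤ n → seq x n ℚ.< seq y n ℚ.+ ε

_<ℝ_ : ℝ → ℝ → Set
x <ℝ y = ∃ λ ε → 0ℚ ℚ.< ε ×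
  ∃ λ N → ∀ n → N ℕ.≤ n → seq x n ℚ.+ ε ℚ.< seq y n

half-pos : ∀ {ε} → 0ℚ ℚ.< ε → 0ℚ ℚ.< ε ℚ.* ½
half-pos 0<ε = ℚ.*-monoˡ-<-pos ½ 0<ε

half+half : ∀ ε → ε ℚ.* ½ ℚ.+ ε ℚ.* ½ ≡ ε
half+half ε = trans (sym (ℚ.*-distribˡ-+ ε ½ ½)) (ℚ.*-identityʳ ε)

abs-bound : ∀ p {ε} → p ℚ.< ε → ℚ.- p ℚ.< ε → ℚ.∣ p ∣ ℚ.< ε
abs-bound p {ε} p<ε -p<ε with ℚ.∣p∣≡p∨∣p∣≡-p p
... | inj₁ eq = subst (ℚ._< ε) (sym eq) p<ε
... | inj₂ eq = subst (ℚ._< ε) (sym eq) -p<ε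

abs-swap : ∀ p q → ℚ.∣ p ℚ.- q ∣ ≡ ℚ.∣ q ℚ.- p ∣
abs-swap p q = trans (sym (ℚ.∣-p∣≡∣p∣ (p ℚ.- q)))
  (cong ℚ.∣_∣ (solve 2 (λ p q → :- (p :- q) := q :- p) refl p q))
  where open +-*-Solver

abs-shift : ∀ p q → ℚ.∣ p ∣ ℚ.≤ ℚ.∣ q ∣ ℚ.+ ℚ.∣ p ℚ.- q ∣
abs-shift p q = subst (λ r → ℚ.∣ r ∣ ℚ.≤ ℚ.∣ q ∣ ℚ.+ ℚ.∣ p ℚ.- q ∣)
  (solve 2 (λ p q → q :+ (p :- q) := p) refl p q) (ℚ.∣p+q∣≤∣p∣+∣q∣ q (p ℚ.- q))
  where open +-*-Solver

const-cauchy : ∀ r → IsCauchy (λ _ → r)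
const-cauchy r ε 0<ε = 0 , λ _ _ _ _ →
  subst (λ d → ℚ.∣ d ∣ ℚ.< ε) (sym (ℚ.+-inverseʳ r)) 0<ε

+-cauchy : ∀ x y → IsCauchy x → IsCauchy y → IsCauchy (λ n → x n ℚ.+ y n)
+-cauchy x y cx cy ε 0<ε with cx (ε ℚ.* ½) (half-pos 0<ε) | cy (ε ℚ.* ½) (half-pos 0<ε)
... | M , hx | N , hy = M ℕ.⊔ N , λ m n Km Kn → begin-strict
  ℚ.∣ (x m ℚ.+ y m) ℚ.- (x n ℚ.+ y n) ∣
    ≡⟨ cong ℚ.∣_∣ (solve 4 (λ a b c d → (a :+ b) :- (c :+ d) := (a :- c) :+ (b :- d))
                     refl (x m) (y m) (x n) (y n)) ⟩
  ℚ.∣ (x m ℚ.- x n) ℚ.+ (y m ℚ.- y n) ∣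
    ≤⟨ ℚ.∣p+q∣≤∣p∣+∣q∣ (x m ℚ.- x n) (y m ℚ.- y n) ⟩
  ℚ.∣ x m ℚ.- x n ∣ ℚ.+ ℚ.∣ y m ℚ.- y n ∣
    <⟨ ℚ.+-mono-< (hx m n (ℕ.m⊔n≤o⇒m≤o M N Km) (ℕ.m⊔n≤o⇒m≤o M N Kn))
                  (hy m n (ℕ.m⊔n≤o⇒n≤o M N Km) (ℕ.m⊔n≤o⇒n≤o M N Kn)) ⟩
  ε ℚ.* ½ ℚ.+ ε ℚ.* ½
    ≡⟨ half+half ε ⟩
  ε ∎
  where open ℚ.≤-Reasoning; open +-*-Solver

neg-cauchy : ∀ x → IsCauchy x → IsCauchy (λ n → ℚ.- x n)
neg-cauchy x cx ε 0<ε with cx ε 0<ε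
... | N , h = N , λ m n Nm Nn → subst (ℚ._< ε)
  (trans (abs-swap (x m) (x n))
    (cong ℚ.∣_∣ (solve 2 (λ a b → b :- a := (:- a) :- (:- b)) refl (x m) (x n))))
  (h m n Nm Nn)
  where open +-*-Solver

cauchy⇒bounded : ∀ x → IsCauchy x →
  ∃ λ B → 0ℚ ℚ.< B × ∃ λ N → ∀ n → N ℕ.≤ n → ℚ.∣ x n ∣ ℚ.≤ B
cauchy⇒bounded x cx with cx 1ℚ (ℚ.positive⁻¹ 1ℚ)
... | N , h = ℚ.∣ x N ∣ ℚ.+ 1ℚ
  , ℚ.+-mono-≤-< (ℚ.0≤∣p∣ (x N)) (ℚ.positive⁻¹ 1ℚ)
  , N , λ n Nn → ℚ.≤-trans (abs-shift (x n) (x N))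
          (ℚ.+-monoʳ-≤ ℚ.∣ x N ∣ (ℚ.<⇒≤ (h n N Nn ℕ.≤-refl)))

split : ∀ {A B ε} → 0ℚ ℚ.< A → 0ℚ ℚ.< B → 0ℚ ℚ.< ε →
  ∃ λ δ → 0ℚ ℚ.< δ × A ℚ.* δ ℚ.+ B ℚ.* δ ≡ ε
split {A} {B} {ε} 0<A 0<B 0<ε = go (A ℚ.+ B) refl (ℚ.+-mono-< 0<A 0<B)
  where
  open ≡-Reasoning
  go : ∀ S → A ℚ.+ B ≡ S → 0ℚ ℚ.< S → ∃ λ δ → 0ℚ ℚ.< δ × A ℚ.* δ ℚ.+ B ℚ.* δ ≡ ε
  go S eq 0<S = ε ℚ.* i
    , ℚ.positive⁻¹ (ε ℚ.* i) {{ℚ.pos*pos⇒pos ε {{ℚ.positive 0<ε}} i {{ℚ.1/pos⇒pos S}}}}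
    , (begin
      A ℚ.* (ε ℚ.* i) ℚ.+ B ℚ.* (ε ℚ.* i) ≡⟨ ℚ.*-distribʳ-+ (ε ℚ.* i) A B ⟨
      (A ℚ.+ B) ℚ.* (ε ℚ.* i)             ≡⟨ cong (ℚ._* (ε ℚ.* i)) eq ⟩
      S ℚ.* (ε ℚ.* i)                     ≡⟨ cong (S ℚ.*_) (ℚ.*-comm ε i) ⟩
      S ℚ.* (i ℚ.* ε)                     ≡⟨ ℚ.*-assoc S i ε ⟨
      S ℚ.* i ℚ.* ε                       ≡⟨ cong (ℚ._* ε) (ℚ.*-inverseʳ S) ⟩
      1ℚ ℚ.* ε                            ≡⟨ ℚ.*-identityˡ ε ⟩
      ε                                   ∎)
    where
    instance
      S⁺  = ℚ.positive 0<S
      S≢0 = ℚ.pos⇒nonZero S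
    i = ℚ.1/ S

*-difference : ∀ a b c d → a ℚ.* b ℚ.- c ℚ.* d ≡ a ℚ.* (b ℚ.- d) ℚ.+ d ℚ.* (a ℚ.- c)
*-difference = solve 4 (λ a b c d → a :* b :- c :* d := a :* (b :- d) :+ d :* (a :- c)) refl
  where open +-*-Solver

*-difference-bound : ∀ {A B δ} → 0ℚ ℚ.< A → 0ℚ ℚ.< B → ∀ a b c d →
  ℚ.∣ a ∣ ℚ.≤ A → ℚ.∣ d ∣ ℚ.≤ B → ℚ.∣ b ℚ.- d ∣ ℚ.< δ → ℚ.∣ a ℚ.- c ∣ ℚ.< δ →
  ℚ.∣ a ℚ.* b ℚ.- c ℚ.* d ∣ ℚ.< A ℚ.* δ ℚ.+ B ℚ.* δ
*-difference-bound {A} {B} {δ} 0<A 0<B a b c d a≤A d≤B b-d<δ a-c<δ = begin-strict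
  ℚ.∣ a ℚ.* b ℚ.- c ℚ.* d ∣
    ≡⟨ cong ℚ.∣_∣ (*-difference a b c d) ⟩
  ℚ.∣ a ℚ.* (b ℚ.- d) ℚ.+ d ℚ.* (a ℚ.- c) ∣
    ≤⟨ ℚ.∣p+q∣≤∣p∣+∣q∣ (a ℚ.* (b ℚ.- d)) (d ℚ.* (a ℚ.- c)) ⟩
  ℚ.∣ a ℚ.* (b ℚ.- d) ∣ ℚ.+ ℚ.∣ d ℚ.* (a ℚ.- c) ∣
    ≡⟨ cong₂ ℚ._+_ (ℚ.∣p*q∣≡∣p∣*∣q∣ a (b ℚ.- d)) (ℚ.∣p*q∣≡∣p∣*∣q∣ d (a ℚ.- c)) ⟩
  ℚ.∣ a ∣ ℚ.* ℚ.∣ b ℚ.- d ∣ ℚ.+ ℚ.∣ d ∣ ℚ.* ℚ.∣ a ℚ.- c ∣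
    ≤⟨ ℚ.+-mono-≤
         (ℚ.*-monoʳ-≤-nonNeg ℚ.∣ b ℚ.- d ∣ {{ℚ.∣-∣-nonNeg (b ℚ.- d)}} a≤A)
         (ℚ.*-monoʳ-≤-nonNeg ℚ.∣ a ℚ.- c ∣ {{ℚ.∣-∣-nonNeg (a ℚ.- c)}} d≤B) ⟩
  A ℚ.* ℚ.∣ b ℚ.- d ∣ ℚ.+ B ℚ.* ℚ.∣ a ℚ.- c ∣
    <⟨ ℚ.+-mono-<
         (ℚ.*-monoʳ-<-pos A {{ℚ.positive 0<A}} b-d<δ)
         (ℚ.*-monoʳ-<-pos B {{ℚ.positive 0<B}} a-c<δ) ⟩
  A ℚ.* δ ℚ.+ B ℚ.* δ ∎
  where open ℚ.≤-Reasoning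

*-cauchy : ∀ x y → IsCauchy x → IsCauchy y → IsCauchy (λ n → x n ℚ.* y n)
*-cauchy x y cx cy ε 0<ε =
  let A , 0<A , M , hA = cauchy⇒bounded x cx
      B , 0<B , N , hB = cauchy⇒bounded y cy
      δ , 0<δ , δ-spec = split 0<A 0<B 0<ε
      K₁ , h₁ = cx δ 0<δ
      K₂ , h₂ = cy δ 0<δ
      L≤ : ∀ {i} → (M ℕ.⊔ N) ℕ.⊔ (K₁ ℕ.⊔ K₂) ℕ.≤ i → M ℕ.⊔ N ℕ.≤ i
      L≤ = ℕ.m⊔n≤o⇒m≤o (M ℕ.⊔ N) (K₁ ℕ.⊔ K₂)
      R≤ : ∀ {i} → (M ℕ.⊔ N) ℕ.⊔ (K₁ ℕ.⊔ K₂) ℕ.≤ i → K₁ ℕ.⊔ K₂ ℕ.≤ i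
      R≤ = ℕ.m⊔n≤o⇒n≤o (M ℕ.⊔ N) (K₁ ℕ.⊔ K₂)
  in (M ℕ.⊔ N) ℕ.⊔ (K₁ ℕ.⊔ K₂) , λ m n Km Kn →
    subst (ℚ.∣ x m ℚ.* y m ℚ.- x n ℚ.* y n ∣ ℚ.<_) δ-spec
      (*-difference-bound 0<A 0<B (x m) (y m) (x n) (y n)
        (hA m (ℕ.m⊔n≤o⇒m≤o M N (L≤ Km)))
        (hB n (ℕ.m⊔n≤o⇒n≤o M N (L≤ Kn)))
        (h₂ m n (ℕ.m⊔n≤o⇒n≤o K₁ K₂ (R≤ Km)) (ℕ.m⊔n≤o⇒n≤o K₁ K₂ (R≤ Kn)))
        (h₁ m n (ℕ.m⊔n≤o⇒m≤o K₁ K₂ (R≤ Km)) (ℕ.m⊔n≤o⇒m≤o K₁ K₂ (R≤ Kn))))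

infixl 6 _+ℝ_ _-ℝ_
infixl 7 _*ℝ_
infix  8 -ℝ_

fromℚ : ℚ → ℝ
fromℚ r = mkℝ (λ _ → r) (const-cauchy r)

fromℕ : ℕ → ℝ
fromℕ k = fromℚ (+ k ℚ./ 1)

0ℝ 1ℝ : ℝ
0ℝ = fromℚ 0ℚ
1ℝ = fromℚ 1ℚ

_+ℝ_ : ℝ → ℝ → ℝ
x +ℝ y = mkℝ (λ n → seq x n ℚ.+ seq y n) (+-cauchy (seq x) (seq y) (cauchy x) (cauchy y))

-ℝ_ : ℝ → ℝ
-ℝ x = mkℝ (λ n → ℚ.- seq x n) (neg-cauchy (seq x) (cauchy x))

_-ℝ_ : ℝ → ℝ → ℝ
x -ℝ y = x +ℝ (-ℝ y)

_*ℝ_ : ℝ → ℝ → ℝ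
x *ℝ y = mkℝ (λ n → seq x n ℚ.* seq y n) (*-cauchy (seq x) (seq y) (cauchy x) (cauchy y))

isqrt : ℕ → ℕ
isqrt zero = zero
isqrt (suc n) with suc (isqrt n) ℕ.* suc (isqrt n) ℕ.≤? suc n
... | yes _ = suc (isqrt n)
... | no  _ = isqrt n

isqrt-lower : ∀ n → isqrt n ℕ.* isqrt n ℕ.≤ n
isqrt-lower zero = ℕ.z≤n
isqrt-lower (suc n) with suc (isqrt n) ℕ.* suc (isqrt n) ℕ.≤? suc n
... | yes h = h
... | no  _ = ℕ.m≤n⇒m≤1+n (isqrt-lower n)

isqrt-upper : ∀ n → n ℕ.< suc (isqrt n) ℕ.* suc (isqrt n)
isqrt-upper zero = ℕ.s≤s ℕ.z≤n
isqrt-upper (suc n) with suc (isqrt n) ℕ.* suc (isqrt n) ℕ.≤? suc n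
... | yes _ = ℕ.≤-<-trans (isqrt-upper n)
                (ℕ.*-mono-< (ℕ.n<1+n (suc (isqrt n))) (ℕ.n<1+n (suc (isqrt n))))
... | no ¬h = ℕ.≰⇒> ¬h

-- With k = suc j, the largest m such that (m / k)² ≤ ∣ r ∣.
√-num : ℕ → ℚ → ℕ
√-num j r = isqrt (ℤ.∣ ↥ r ∣ ℕ.* (suc j ℕ.* suc j) ℕ./ ↧ₙ r)

-- Approximation from below of the square root of ∣ r ∣, with error less than 1 / suc j.
√-approx : ℕ → ℚ → ℚ
√-approx j r = + √-num j r ℚ./ suc j

√-approx-lower : ∀ j r → √-approx j r ℚ.* √-approx j r ℚ.≤ ℚ.∣ r ∣
√-approx-lower j r@(mkℚ a d-1 _) = ℚ.toℚᵘ-cancel-≤ (begin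
  ℚ.toℚᵘ (s ℚ.* s)         ≃⟨ ℚ.toℚᵘ-homo-* s s ⟩
  ℚ.toℚᵘ s ℚᵘ.* ℚ.toℚᵘ s   ≃⟨ ℚᵘ.*-cong s≃ s≃ ⟩
  sᵘ ℚᵘ.* sᵘ               ≤⟨ ℚᵘ.*≤* (subst₂ ℤ._≤_
                                 (trans (ℤ.pos-* (m ℕ.* m) (suc d-1)) (cong (ℤ._* + suc d-1) (ℤ.pos-* m m)))
                                 (ℤ.pos-* ℤ.∣ a ∣ (suc j ℕ.* suc j))
                                 (ℤ.+≤+ nat)) ⟩
  ℚ.toℚᵘ ℚ.∣ r ∣           ∎)
  where
  open ℚᵘ.≤-Reasoning
  m  = √-num j r
  s  = √-approx j r
  sᵘ = ℚᵘ.mkℚᵘ (+ m) j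
  s≃ = ℚ.toℚᵘ-fromℚᵘ sᵘ
  nat : m ℕ.* m ℕ.* suc d-1 ℕ.≤ ℤ.∣ a ∣ ℕ.* (suc j ℕ.* suc j)
  nat = ℕ.≤-trans (ℕ.*-monoˡ-≤ (suc d-1) (isqrt-lower (ℤ.∣ a ∣ ℕ.* (suc j ℕ.* suc j) ℕ./ suc d-1)))
          (ℕ.m/n*n≤m (ℤ.∣ a ∣ ℕ.* (suc j ℕ.* suc j)) (suc d-1))

√-approx-upper : ∀ j r → let t = √-approx j r ℚ.+ + 1 ℚ./ suc j in ℚ.∣ r ∣ ℚ.< t ℚ.* t
√-approx-upper j r@(mkℚ a d-1 _) = ℚ.toℚᵘ-cancel-< (begin-strict
  ℚ.toℚᵘ ℚ.∣ r ∣           <⟨ ℚᵘ.*<* (subst₂ ℤ._<_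
                                 (ℤ.pos-* ℤ.∣ a ∣ (suc j ℕ.* suc j))
                                 (trans (ℤ.pos-* (suc m ℕ.* suc m) (suc d-1)) (cong (ℤ._* + suc d-1) (ℤ.pos-* (suc m) (suc m))))
                                 (ℤ.+<+ nat)) ⟩
  tᵘ ℚᵘ.* tᵘ               ≃⟨ ℚᵘ.*-cong t≃ t≃ ⟨
  ℚ.toℚᵘ t ℚᵘ.* ℚ.toℚᵘ t   ≃⟨ ℚ.toℚᵘ-homo-* t t ⟨
  ℚ.toℚᵘ (t ℚ.* t)         ∎)
  where
  open ℚᵘ.≤-Reasoning
  m  = √-num j r
  s  = √-approx j r
  t  = s ℚ.+ + 1 ℚ./ suc j
  tᵘ = ℚᵘ.mkℚᵘ (+ suc m) j
  add : ℚᵘ.mkℚᵘ (+ m) j ℚᵘ.+ ℚᵘ.mkℚᵘ (+ 1) j ℚᵘ.≃ tᵘ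
  add = ℚᵘ.*≡* (trans
    (cong (ℤ._* + suc j) (trans (sym (ℤ.*-distribʳ-+ (+ suc j) (+ m) (+ 1)))
      (cong (λ z → + z ℤ.* + suc j) (ℕ.+-comm m 1))))
    (trans (ℤ.*-assoc (+ suc m) (+ suc j) (+ suc j))
      (cong (+ suc m ℤ.*_) (sym (ℤ.pos-* (suc j) (suc j))))))
  t≃ : ℚ.toℚᵘ t ℚᵘ.≃ tᵘ
  t≃ = ℚᵘ.≃-trans (ℚ.toℚᵘ-homo-+ s (+ 1 ℚ./ suc j))
         (ℚᵘ.≃-trans (ℚᵘ.+-cong (ℚ.toℚᵘ-fromℚᵘ (ℚᵘ.mkℚᵘ (+ m) j)) (ℚ.toℚᵘ-fromℚᵘ (ℚᵘ.mkℚᵘ (+ 1) j))) add)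
  c = ℤ.∣ a ∣ ℕ.* (suc j ℕ.* suc j)
  nat : c ℕ.< suc m ℕ.* suc m ℕ.* suc d-1
  nat = ℕ.<-≤-trans
    (subst (ℕ._< suc (c ℕ./ suc d-1) ℕ.* suc d-1) (sym (ℕ.m≡m%n+[m/n]*n c (suc d-1)))
      (ℕ.+-monoˡ-< (c ℕ./ suc d-1 ℕ.* suc d-1) (ℕ.m%n<n c (suc d-1))))
    (ℕ.*-monoˡ-≤ (suc d-1) (isqrt-upper (c ℕ./ suc d-1)))

√-approx-nonNeg : ∀ j r → 0ℚ ℚ.≤ √-approx j r
√-approx-nonNeg j r = ℚ.nonNegative⁻¹ (√-approx j r)
  {{ℚ.normalize-nonNeg (√-num j r) (suc j)}}

archimedean : ∀ ε → 0ℚ ℚ.< ε → ∃ λ N → ∀ n → N ℕ.≤ n → + 1 ℚ./ suc n ℚ.≤ ε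
archimedean (mkℚ (+ zero) d-1 _) 0<ε with ℚ.positive 0<ε
... | ()
archimedean (mkℚ ℤ.-[1+ p ] d-1 _) 0<ε with ℚ.positive 0<ε
... | ()
archimedean (mkℚ (+ suc p) d-1 _) 0<ε = d-1 , λ n d≤n → ℚ.toℚᵘ-cancel-≤
  (ℚᵘ.≤-respˡ-≃ (ℚᵘ.≃-sym (ℚ.toℚᵘ-fromℚᵘ (ℚᵘ.mkℚᵘ (+ 1) n)))
    (ℚᵘ.*≤* (subst₂ ℤ._≤_ (ℤ.pos-* 1 (suc d-1)) (ℤ.pos-* (suc p) (suc n))
      (ℤ.+≤+ (ℕ.*-mono-≤ {1} {suc p} (ℕ.s≤s ℕ.z≤n) (ℕ.s≤s d≤n))))))

square-cancel-< : ∀ p t → 0ℚ ℚ.≤ t → p ℚ.* p ℚ.< t ℚ.* t → p ℚ.< t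
square-cancel-< p t 0≤t pp<tt with p ℚ.<? t
... | yes p<t = p<t
... | no  p≮t = contradiction (ℚ.<-≤-trans pp<tt (ℚ.≤-trans
        (ℚ.*-monoˡ-≤-nonNeg t {{ℚ.nonNegative 0≤t}} t≤p)
        (ℚ.*-monoʳ-≤-nonNeg p {{ℚ.nonNegative (ℚ.≤-trans 0≤t t≤p)}} t≤p))) (ℚ.<-irrefl refl)
  where t≤p = ℚ.≮⇒≥ p≮t

square-sum-< : ∀ a b c t δ → 0ℚ ℚ.≤ t → 0ℚ ℚ.< δ →
  a ℚ.≤ b ℚ.+ c → b ℚ.< t ℚ.* t → c ℚ.< δ ℚ.* δ → a ℚ.< (t ℚ.+ δ) ℚ.* (t ℚ.+ δ)
square-sum-< a b c t δ 0≤t 0<δ a≤b+c b<tt c<δδ = begin-strict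
  a                                                   ≤⟨ a≤b+c ⟩
  b ℚ.+ c                                             <⟨ ℚ.+-mono-< b<tt c<δδ ⟩
  t ℚ.* t ℚ.+ δ ℚ.* δ                                 ≡⟨ ℚ.+-identityʳ _ ⟨
  (t ℚ.* t ℚ.+ δ ℚ.* δ) ℚ.+ 0ℚ                        ≤⟨ ℚ.+-monoʳ-≤ (t ℚ.* t ℚ.+ δ ℚ.* δ) (ℚ.+-mono-≤ 0≤tδ 0≤tδ) ⟩
  (t ℚ.* t ℚ.+ δ ℚ.* δ) ℚ.+ (t ℚ.* δ ℚ.+ t ℚ.* δ)     ≡⟨ expand t δ ⟩
  (t ℚ.+ δ) ℚ.* (t ℚ.+ δ)                             ∎
  where
  open ℚ.≤-Reasoning
  open +-*-Solver
  expand : ∀ t d → (t ℚ.* t ℚ.+ d ℚ.* d) ℚ.+ (t ℚ.* d ℚ.+ t ℚ.* d) ≡ (t ℚ.+ d) ℚ.* (t ℚ.+ d)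
  expand = solve 2 (λ t d → (t :* t :+ d :* d) :+ (t :* d :+ t :* d) := (t :+ d) :* (t :+ d)) refl
  0≤tδ : 0ℚ ℚ.≤ t ℚ.* δ
  0≤tδ = subst (ℚ._≤ t ℚ.* δ) (ℚ.*-zeroʳ t)
    (ℚ.*-monoˡ-≤-nonNeg t {{ℚ.nonNegative 0≤t}} (ℚ.<⇒≤ 0<δ))

<-+⇒-< : ∀ p q r → p ℚ.< q ℚ.+ r → p ℚ.- q ℚ.< r
<-+⇒-< p q r h = subst (p ℚ.- q ℚ.<_) (cancel q r) (ℚ.+-monoˡ-< (ℚ.- q) h)
  where
  open +-*-Solver
  cancel : ∀ q r → (q ℚ.+ r) ℚ.- q ≡ r
  cancel = solve 2 (λ q r → (q :+ r) :- q := r) refl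

neg-difference : ∀ p q → q ℚ.- p ≡ ℚ.- (p ℚ.- q)
neg-difference = solve 2 (λ p q → q :- p := :- (p :- q)) refl
  where open +-*-Solver

√-approx-step : ∀ i j a b {δ} → 0ℚ ℚ.< δ → ℚ.∣ a ℚ.- b ∣ ℚ.< δ ℚ.* δ → + 1 ℚ./ suc j ℚ.≤ δ →
  √-approx i a ℚ.- √-approx j b ℚ.< δ ℚ.+ δ
√-approx-step i j a b {δ} 0<δ a-b<δδ 1/j≤δ = <-+⇒-< (√-approx i a) (√-approx j b) (δ ℚ.+ δ) (ℚ.<-≤-trans
    (square-cancel-< (√-approx i a) (√-approx j b ℚ.+ + 1 ℚ./ suc j ℚ.+ δ) (ℚ.+-mono-≤ 0≤t (ℚ.<⇒≤ 0<δ))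
      (square-sum-< (√-approx i a ℚ.* √-approx i a) ℚ.∣ b ∣ ℚ.∣ a ℚ.- b ∣ (√-approx j b ℚ.+ + 1 ℚ./ suc j) δ
        0≤t 0<δ (ℚ.≤-trans (√-approx-lower i a) (abs-shift a b))
        (√-approx-upper j b) a-b<δδ))
    (ℚ.≤-trans (ℚ.≤-reflexive (ℚ.+-assoc (√-approx j b) (+ 1 ℚ./ suc j) δ))
      (ℚ.+-monoʳ-≤ (√-approx j b) (ℚ.+-monoˡ-≤ δ 1/j≤δ))))
  where
  0≤t : 0ℚ ℚ.≤ √-approx j b ℚ.+ + 1 ℚ./ suc j
  0≤t = ℚ.+-mono-≤ (√-approx-nonNeg j b)
          (ℚ.nonNegative⁻¹ (+ 1 ℚ./ suc j) {{ℚ.normalize-nonNeg 1 (suc j)}})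

√-cauchy : ∀ x → IsCauchy x → IsCauchy (λ n → √-approx n (x n))
√-cauchy x cx ε 0<ε = go (ε ℚ.* ½) (half-pos 0<ε) (half+half ε)
  where
  s : ℕ → ℚ
  s n = √-approx n (x n)

  go : ∀ δ → 0ℚ ℚ.< δ → δ ℚ.+ δ ≡ ε →
    ∃ λ N → ∀ m n → N ℕ.≤ m → N ℕ.≤ n → ℚ.∣ s m ℚ.- s n ∣ ℚ.< ε
  go δ 0<δ δ+δ≡ε =
    let K₁ , h₁ = cx (δ ℚ.* δ) (ℚ.positive⁻¹ (δ ℚ.* δ)
                    {{ℚ.pos*pos⇒pos δ {{ℚ.positive 0<δ}} δ {{ℚ.positive 0<δ}}}})
        K₂ , h₂ = archimedean δ 0<δ
        one-sided : ∀ m n → K₁ ℕ.⊔ K₂ ℕ.≤ m → K₁ ℕ.⊔ K₂ ℕ.≤ n → s m ℚ.- s n ℚ.< ε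
        one-sided = λ m n Km Kn → subst (s m ℚ.- s n ℚ.<_) δ+δ≡ε
          (√-approx-step m n (x m) (x n) 0<δ
            (h₁ m n (ℕ.m⊔n≤o⇒m≤o K₁ K₂ Km) (ℕ.m⊔n≤o⇒m≤o K₁ K₂ Kn))
            (h₂ n (ℕ.m⊔n≤o⇒n≤o K₁ K₂ Kn)))
    in K₁ ℕ.⊔ K₂ , λ m n Km Kn → abs-bound (s m ℚ.- s n)
      (one-sided m n Km Kn)
      (subst (ℚ._< ε) (neg-difference (s m) (s n)) (one-sided n m Kn Km))

-- The square root of ∣ x ∣, hence of x when x is nonnegative.
√ℝ : ℝ → ℝ
√ℝ x = mkℝ (λ n → √-approx n (seq x n)) (√-cauchy (seq x) (cauchy x))

record ℂ : Set where
  constructor _+i_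
  field
    re im : ℝ

open ℂ public

infix  4 _≈ℂ_
infixl 6 _+ℂ_
infixl 7 _*ℂ_

_≈ℂ_ : ℂ → ℂ → Set
z ≈ℂ w = re z ≈ℝ re w × im z ≈ℝ im w

0ℂ 1ℂ : ℂ
0ℂ = 0ℝ +i 0ℝ
1ℂ = 1ℝ +i 0ℝ

_+ℂ_ : ℂ → ℂ → ℂ
z +ℂ w = (re z +ℝ re w) +i (im z +ℝ im w)

_*ℂ_ : ℂ → ℂ → ℂ
z *ℂ w = (re z *ℝ re w -ℝ im z *ℝ im w) +i (re z *ℝ im w +ℝ im z *ℝ re w)

∣_∣ℂ : ℂ → ℝ
∣ z ∣ℂ = √ℝ (re z *ℝ re z +ℝ im z *ℝ im z)

sumℂ : List ℂ → ℂ
sumℂ = foldr _+ℂ_ 0ℂ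

-- A field with exactly q elements.  One exists only when q is a prime power,
-- and it is then unique up to isomorphism, so that quantifying over all q and
-- all F : FiniteField q amounts to quantifying over the fields 𝔽_q, q a prime power.
record FiniteField (q : ℕ) : Set₁ where
  infix  8 -_
  infixl 7 _*_
  infixl 6 _+_
  field
    Carrier           : Set
    _+_ _*_           : Carrier → Carrier → Carrier
    -_                : Carrier → Carrier
    0# 1#             : Carrier
    isCommutativeRing : IsCommutativeRing _≡_ _+_ _*_ -_ 0# 1#
    0≢1               : 0# ≢ 1#
    inverse           : ∀ x → x ≢ 0# → ∃ λ y → x * y ≡ 1#
    enumeration       : Fin q ↔ Carrier

  commutativeRing : CommutativeRing 0ℓ 0ℓ
  commutativeRing = record { isCommutativeRing = isCommutativeRing }

  open RawMonoidDefs (CommutativeRing.+-rawMonoid commutativeRing) public using (sum)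

  index : Carrier → Fin q
  index = Inverse.from enumeration

  element : Fin q → Carrier
  element = Inverse.to enumeration

  element-index : ∀ x → element (index x) ≡ x
  element-index x = Inverse.inverseˡ enumeration refl

  _≟_ : DecidableEquality Carrier
  _≟_ = Fin.inj⇒≟ (mk↣ {to = index} λ {x} {y} eq →
    trans (sym (element-index x)) (trans (cong element eq) (element-index y)))

  elements : List Carrier
  elements = map element (allFin q)

  ∈-elements : ∀ x → x ∈ elements
  ∈-elements x = subst (_∈ elements) (element-index x) (∈-map⁺ element (∈-allFin (index x)))

vectors : ∀ {A : Set} → List A → ∀ n → List (Vec A n)
vectors xs zero    = [] ∷ []
vectors xs (suc n) = cartesianProductWith _∷_ xs (vectors xs n)

∈-vectors : ∀ {A : Set} {xs : List A} → (∀ x → x ∈ xs) → ∀ {n} (v : Vec A n) → v ∈ vectors xs n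
∈-vectors all∈ []      = here refl
∈-vectors all∈ (x ∷ v) = ∈-cartesianProductWith⁺ _∷_ (all∈ x) (∈-vectors all∈ v)

module _ {q : ℕ} (F : FiniteField q) where
  open FiniteField F

  Matrix : ℕ → Set
  Matrix n = Vec (Vec Carrier n) n

  module _ {n : ℕ} where

    entry : Matrix n → Fin n → Fin n → Carrier
    entry X i j = lookup (lookup X i) j

    0ᴹ : Matrix n
    0ᴹ = replicate n (replicate n 0#)

    1ᴹ : Matrix n
    1ᴹ = tabulate λ i → tabulate λ j → δ i j
      where
      δ : Fin n → Fin n → Carrier
      δ i j with i Fin.≟ j
      ... | yes _ = 1#
      ... | no  _ = 0#

    _*ᴹ_ : Matrix n → Matrix n → Matrix n
    X *ᴹ Y = tabulate λ i → tabulate λ j → sum λ k → entry X i k * entry Y k j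

    -- The entrywise product U · V, as opposed to the matrix product.
    _·_ : Matrix n → Matrix n → Carrier
    U · V = sum λ i → sum λ j → entry U i j * entry V i j

    Invertible : Matrix n → Set
    Invertible X = ∃ λ Y → X *ᴹ Y ≡ 1ᴹ × Y *ᴹ X ≡ 1ᴹ

    _≟ᴹ_ : DecidableEquality (Matrix n)
    _≟ᴹ_ = Vec.≡-dec (Vec.≡-dec _≟_)

  matrices : ∀ n → List (Matrix n)
  matrices n = vectors (vectors elements n) n

  ∈-matrices : ∀ {n} (X : Matrix n) → X ∈ matrices n
  ∈-matrices = ∈-vectors (∈-vectors ∈-elements)

  invertible? : ∀ {n} (X : Matrix n) → Dec (Invertible X)
  invertible? {n} X = map′
    (λ Y∈ → let Y , _ , inv = find Y∈ in Y , inv)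
    (λ (Y , inv) → lose (∈-matrices Y) inv)
    (any? (λ Y → ((X *ᴹ Y) ≟ᴹ 1ᴹ) ×-dec ((Y *ᴹ X) ≟ᴹ 1ᴹ)) (matrices n))

  -- The elements of GL_n(F), each listed once.
  GL : ∀ n → List (Matrix n)
  GL n = filter invertible? (matrices n)

  -- A homomorphism from (F , +) to the group ℂ* of invertible complex numbers.
  record AdditiveCharacter : Set where
    field
      ⟦_⟧  : Carrier → ℂ
      unit : ∀ x → ∃ λ w → ⟦ x ⟧ *ℂ w ≈ℂ 1ℂ
      homo : ∀ x y → ⟦ x + y ⟧ ≈ℂ ⟦ x ⟧ *ℂ ⟦ y ⟧

  Nontrivial : AdditiveCharacter → Set
  Nontrivial χ = ¬ (∀ x → ⟦ x ⟧ ≈ℂ 1ℂ)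
    where open AdditiveCharacter χ

  gaussSum : ∀ {n} → Matrix n → AdditiveCharacter → ℂ
  gaussSum {n} U χ = sumℂ (map (λ X → ⟦ U · X ⟧) (GL n))
    where open AdditiveCharacter χ

{-# OPTIONS --safe #-}

-- Let N a be the number of X ∈ GLₙ with U · X = a.  Rescaling X shows N a = N 1 for all a ≠ 0, and
-- λ has total sum 0, so the Gauss sum is the integer N 0 − N 1.
--
-- Choose i and k with Uᵢₖ ≠ 0.  If some row j ≠ i of X is not orthogonal to row i of U, then adding a
-- multiple of row j to row i moves U · X to any prescribed value; this is reversible, so such X
-- occur equally often in each fibre.  The remaining X in a given fibre are determined by the entries
-- outside column k, so there are at most q^(n(n−1)) of them.  Hence ∣N 0 − N 1∣ ≤ q^(n² − n).
module Submission where

open import Defs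
open import Algebra.Bundles using (CommutativeRing)
import Algebra.Properties.Ring as RingProperties
import Algebra.Properties.Semiring.Sum as SemiringSum
import Algebra.Solver.Ring.NaturalCoefficients.Default as RingSolver
open import Data.Fin as Fin using (Fin; punchIn; punchOut)
import Data.Fin.Properties as Fin
import Data.Integer as ℤ
import Data.Integer.Properties as ℤ
open import Data.List as List using (List; []; _∷_; cartesianProductWith; filter; foldr; length; map)
open import Data.List.Membership.Propositional using (_∈_)
open import Data.List.Membership.Propositional.Properties using (∈-filter⁺; ∈-filter⁻; ∈-map⁺)
open import Data.List.Membership.Propositional.Properties.WithK using (unique∧set⇒bag)
open import Data.List.Properties using (length-++; length-map; length-tabulate; map-∘)
open import Data.List.Relation.Binary.BagAndSetEquality using (∼bag⇒↭)
open import Data.List.Relation.Binary.Permutation.Propositional as ↭ using (_↭_)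
import Data.List.Relation.Binary.Permutation.Propositional.Properties as ↭
import Data.List.Relation.Unary.All as All
open import Data.List.Relation.Unary.AllPairs using ([]; _∷_)
open import Data.List.Relation.Unary.Any using (here; there)
open import Data.List.Relation.Unary.Unique.Propositional using (Unique)
import Data.List.Relation.Unary.Unique.Propositional.Properties as Unique
open import Data.Nat as ℕ using (ℕ; zero; suc; _≤_; _∸_; _^_; z≤n; s≤s)
import Data.Nat.Properties as ℕ
open import Data.Product using (∃; ∃₂; _×_; _,_; proj₁; proj₂)
open import Data.Rational as ℚ using (ℚ; 0ℚ; 1ℚ; ½)
import Data.Rational.Properties as ℚ
open import Data.Rational.Solver using (module +-*-Solver)
import Data.Rational.Unnormalised as ℚᵘ
import Data.Rational.Unnormalised.Properties as ℚᵘ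
open import Data.Sum using (_⊎_; inj₁; inj₂; fromInj₁)
open import Data.Vec as Vec using (Vec; []; _∷_; lookup; removeAt; tabulate)
import Data.Vec.Properties as Vec
open import Function using (_∘_; id; Inverse; mk⇔)
open import Relation.Binary.Definitions using (DecidableEquality)
open import Relation.Binary.PropositionalEquality
open import Relation.Nullary using (¬_; yes; no; contradiction; ¬?)
open import Relation.Nullary.Decidable using (decidable-stable; toWitness)
open import Relation.Unary using (Decidable)

-- That `λ` sums to zero is usually proved by picking `b` with `λ(b) ≠ 1`. Here equality of complex
-- numbers is undecidable and `Nontrivial` is a negated universal statement, so no such `b` can be
-- extracted. The argument is turned round: if the sum were bounded away from zero, it could be
-- cancelled from `λ(b) s ≈ s` for all `b` at once, contradicting nontriviality; hence it is smaller
-- than every positive rational.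
--
-- Reversibility of the row operation is the other delicate point: the new matrix must select the
-- same row `j` and the same multiple up to sign. The selection therefore reads only the products of
-- row `i` of `U` with the rows of `X` other than `i`, none of which the operation changes.
--
-- The passage from the Gauss sum to `N 0 − N 1` is made on rational approximations: at each index
-- of the Cauchy sequences the regrouping by fibres is an exact identity of finite rational sums,
-- and limits are taken only afterwards.

lookup-ext : ∀ {A : Set} {n} {u v : Vec A n} → (∀ i → lookup u i ≡ lookup v i) → u ≡ v
lookup-ext {u = u} {v} eq =
  trans (sym (Vec.tabulate∘lookup u)) (trans (Vec.tabulate-cong eq) (Vec.tabulate∘lookup v))

lookup²∘tabulate² : ∀ {A : Set} {m n} (f : Fin m → Fin n → A) i j →
  lookup (lookup (tabulate λ r → tabulate (f r)) i) j ≡ f i j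
lookup²∘tabulate² f i j =
  trans (cong (λ v → lookup v j) (Vec.lookup∘tabulate (λ r → tabulate (f r)) i)) (Vec.lookup∘tabulate (f i) j)

-- Finite sums and matrices over a finite field.

module LinearAlgebra {q : ℕ} (F : FiniteField q) where
  open FiniteField F
  open CommutativeRing commutativeRing using
    ( commutativeSemiring; semiring; ring; +-assoc; +-identityˡ; +-identityʳ; -‿inverseʳ; -‿inverseˡ
    ; *-assoc; *-comm; *-identityˡ; *-identityʳ; zeroˡ; zeroʳ)
  open SemiringSum semiring using
    (sum-cong-≗; sum-remove; sum-replicate-zero; ∑-distrib-+; *-distribˡ-sum; *-distribʳ-sum)
  open RingProperties ring using (+-cancelˡ)
  open RingSolver commutativeSemiring using (solve; _:+_; _:*_; _:=_)
  open ≡-Reasoning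

  *-cancelˡ : ∀ {c x y} → c ≢ 0# → c * x ≡ c * y → x ≡ y
  *-cancelˡ {c} {x} {y} c≢0 eq = let d , cd≡1 = inverse c c≢0 in begin
    x            ≡⟨ *-identityˡ x ⟨
    1# * x       ≡⟨ cong (_* x) (trans (*-comm d c) cd≡1) ⟨
    d * c * x    ≡⟨ *-assoc d c x ⟩
    d * (c * x)  ≡⟨ cong (d *_) eq ⟩
    d * (c * y)  ≡⟨ *-assoc d c y ⟨
    d * c * y    ≡⟨ cong (_* y) (trans (*-comm d c) cd≡1) ⟩
    1# * y       ≡⟨ *-identityˡ y ⟩
    y            ∎

  -- Both sides are the common part of the two sums plus `f k + g k`. The form without subtraction
  -- lets the semiring solver do the rearrangement.
  sum-differ : ∀ {n} (k : Fin n) (f g : Fin n → Carrier) → (∀ l → l ≢ k → f l ≡ g l) →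
    sum f + g k ≡ sum g + f k
  sum-differ {suc n} k f g eq = begin
    sum f + g k                             ≡⟨ cong (_+ g k) (sum-remove {i = k} f) ⟩
    f k + sum (λ l → f (punchIn k l)) + g k
      ≡⟨ cong (λ s → f k + s + g k) (sum-cong-≗ λ l → eq (punchIn k l) (Fin.punchInᵢ≢i k l)) ⟩
    f k + sum (λ l → g (punchIn k l)) + g k
      ≡⟨ solve 3 (λ a b c → a :+ b :+ c := c :+ b :+ a) refl (f k) (sum (λ l → g (punchIn k l))) (g k) ⟩
    g k + sum (λ l → g (punchIn k l)) + f k ≡⟨ cong (_+ f k) (sum-remove {i = k} g) ⟨
    sum g + f k                             ∎

  -- Needed at two levels when a matrix without pivot is reconstructed: for the missing entry of a
  -- row, and for the missing row in `U · X`.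
  sum-determines : ∀ {n} (k : Fin n) (f g : Fin n → Carrier) → (∀ l → l ≢ k → f l ≡ g l) →
    sum f ≡ sum g → f k ≡ g k
  sum-determines k f g eq sf≡sg = sym (+-cancelˡ (sum g) (g k) (f k)
    (trans (cong (_+ g k) (sym sf≡sg)) (sum-differ k f g eq)))

  sum-single : ∀ {n} (k : Fin n) (f : Fin n → Carrier) → (∀ l → l ≢ k → f l ≡ 0#) → sum f ≡ f k
  sum-single {n} k f eq = begin
    sum f                 ≡⟨ +-identityʳ (sum f) ⟨
    sum f + 0#            ≡⟨ sum-differ k f (λ _ → 0#) eq ⟩
    sum {n} (λ _ → 0#) + f k  ≡⟨ cong (_+ f k) (sum-replicate-zero n) ⟩
    0# + f k              ≡⟨ +-identityˡ (f k) ⟩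
    f k                   ∎

  δ : ∀ {n} → Fin n → Fin n → Carrier
  δ = entry F (1ᴹ F)

  -- Exposes the function local to 1ᴹ, which cannot be named, to case analysis.
  δ-value : ∀ {n} (i j : Fin n) → ∃ λ x → δ i j ≡ x
  δ-value i j = _ , lookup²∘tabulate² _ i j

  δ≡1 : ∀ {n} (i : Fin n) → δ i i ≡ 1#
  δ≡1 i = trans (proj₂ (δ-value i i)) value
    where
    value : proj₁ (δ-value i i) ≡ 1#
    value with i Fin.≟ i
    ... | yes _   = refl
    ... | no  i≢i = contradiction refl i≢i

  δ≡0 : ∀ {n} {i j : Fin n} → i ≢ j → δ i j ≡ 0#
  δ≡0 {i = i} {j} i≢j = trans (proj₂ (δ-value i j)) value
    where
    value : proj₁ (δ-value i j) ≡ 0#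
    value with i Fin.≟ j
    ... | yes i≡j = contradiction i≡j i≢j
    ... | no  _   = refl

  sum-δʳ : ∀ {n} (f : Fin n → Carrier) i → sum (λ k → f k * δ k i) ≡ f i
  sum-δʳ f i = trans
    (sum-single i (λ k → f k * δ k i) λ k k≢i → trans (cong (f k *_) (δ≡0 k≢i)) (zeroʳ (f k)))
    (trans (cong (f i *_) (δ≡1 i)) (*-identityʳ (f i)))

  sum-δˡ : ∀ {n} (f : Fin n → Carrier) i → sum (λ k → δ i k * f k) ≡ f i
  sum-δˡ f i = trans
    (sum-single i (λ k → δ i k * f k) λ k k≢i → trans (cong (_* f k) (δ≡0 (k≢i ∘ sym))) (zeroˡ (f k)))
    (trans (cong (_* f i) (δ≡1 i)) (*-identityˡ (f i)))

  dot : ∀ {n} → Vec Carrier n → Vec Carrier n → Carrier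
  dot u v = sum λ l → lookup u l * lookup v l

  matrix : ∀ {n} → (Fin n → Fin n → Carrier) → Matrix F n
  matrix f = tabulate λ i → tabulate (f i)

  entry-matrix : ∀ {n} (f : Fin n → Fin n → Carrier) i j → entry F (matrix f) i j ≡ f i j
  entry-matrix = lookup²∘tabulate²

  matrix-ext : ∀ {n} {X Y : Matrix F n} → (∀ i j → entry F X i j ≡ entry F Y i j) → X ≡ Y
  matrix-ext eq = lookup-ext λ i → lookup-ext (eq i)

  product⇒ : ∀ {n} (X Y : Matrix F n) → _*ᴹ_ F X Y ≡ 1ᴹ F →
    ∀ r s → sum (λ k → entry F X r k * entry F Y k s) ≡ δ r s
  product⇒ X Y XY≡1 r s =
    trans (sym (entry-matrix (λ r s → sum λ k → entry F X r k * entry F Y k s) r s))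
          (cong (λ Z → entry F Z r s) XY≡1)

  product⇐ : ∀ {n} (f g : Fin n → Fin n → Carrier) → (∀ r s → sum (λ k → f r k * g k s) ≡ δ r s) →
    _*ᴹ_ F (matrix f) (matrix g) ≡ 1ᴹ F
  product⇐ f g eq = matrix-ext λ r s → begin
    entry F (_*ᴹ_ F (matrix f) (matrix g)) r s
      ≡⟨ entry-matrix (λ r s → sum λ k → entry F (matrix f) r k * entry F (matrix g) k s) r s ⟩
    sum (λ k → entry F (matrix f) r k * entry F (matrix g) k s)
      ≡⟨ sum-cong-≗ (λ k → cong₂ _*_ (entry-matrix f r k) (entry-matrix g k s)) ⟩
    sum (λ k → f r k * g k s)  ≡⟨ eq r s ⟩
    δ r s                      ∎

  -- Multiplication of a matrix by a scalar.

  scale : ∀ {n} → Carrier → Matrix F n → Matrix F n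
  scale c X = matrix λ i j → c * entry F X i j

  scale-· : ∀ {n} c (U X : Matrix F n) → _·_ F U (scale c X) ≡ c * _·_ F U X
  scale-· c U X = sym (begin
    c * sum (λ i → sum λ j → entry F U i j * entry F X i j)
      ≡⟨ *-distribˡ-sum c (λ i → sum λ j → entry F U i j * entry F X i j) ⟩
    sum (λ i → c * sum λ j → entry F U i j * entry F X i j)
      ≡⟨ sum-cong-≗ (λ i → *-distribˡ-sum c (λ j → entry F U i j * entry F X i j)) ⟩
    sum (λ i → sum λ j → c * (entry F U i j * entry F X i j))
      ≡⟨ sum-cong-≗ (λ i → sum-cong-≗ λ j →
           trans (solve 3 (λ a b c → a :* (b :* c) := b :* (a :* c)) refl c (entry F U i j) (entry F X i j))
                 (cong (entry F U i j *_) (sym (entry-matrix (λ i j → c * entry F X i j) i j)))) ⟩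
    _·_ F U (scale c X) ∎)

  scale-inverse : ∀ {n} {c d} → c * d ≡ 1# → (X : Matrix F n) → scale c (scale d X) ≡ X
  scale-inverse {c = c} {d} cd≡1 X = matrix-ext λ i j → begin
    entry F (scale c (scale d X)) i j ≡⟨ entry-matrix (λ i j → c * entry F (scale d X) i j) i j ⟩
    c * entry F (scale d X) i j       ≡⟨ cong (c *_) (entry-matrix (λ i j → d * entry F X i j) i j) ⟩
    c * (d * entry F X i j)           ≡⟨ *-assoc c d (entry F X i j) ⟨
    c * d * entry F X i j             ≡⟨ cong (_* entry F X i j) cd≡1 ⟩
    1# * entry F X i j                ≡⟨ *-identityˡ (entry F X i j) ⟩
    entry F X i j                     ∎

  scale-invertible : ∀ {n} {c} → c ≢ 0# → (X : Matrix F n) → Invertible F X → Invertible F (scale c X)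
  scale-invertible {n} {c} c≢0 X (Y , XY≡1 , YX≡1) = let d , cd≡1 = inverse c c≢0 in
    scale d Y , product c d cd≡1 X Y XY≡1 , product d c (trans (*-comm d c) cd≡1) Y X YX≡1
    where
    product : ∀ c d → c * d ≡ 1# → (X Y : Matrix F n) → _*ᴹ_ F X Y ≡ 1ᴹ F →
      _*ᴹ_ F (scale c X) (scale d Y) ≡ 1ᴹ F
    product c d cd≡1 X Y XY≡1 =
      product⇐ (λ i j → c * entry F X i j) (λ i j → d * entry F Y i j) λ r s → begin
        sum (λ k → c * entry F X r k * (d * entry F Y k s))
          ≡⟨ sum-cong-≗ (λ k → trans
               (solve 4 (λ c x d y → c :* x :* (d :* y) := c :* d :* (x :* y)) refl c (entry F X r k) d (entry F Y k s))
               (trans (cong (_* (entry F X r k * entry F Y k s)) cd≡1) (*-identityˡ _))) ⟩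
        sum (λ k → entry F X r k * entry F Y k s) ≡⟨ product⇒ X Y XY≡1 r s ⟩
        δ r s ∎

  -- Elementary row operations.

  -- Both products in `shear-invertible` have this shape: a row perturbed along `g` meets a column
  -- perturbed along `l`. There each of the four sums on the right is an entry of a known product or
  -- collapses against a `δ`.
  sum-bilinear : ∀ {n} (f g h l : Fin n → Carrier) a b →
    sum (λ k → (f k + a * g k) * (h k + l k * b)) ≡
    sum (λ k → f k * h k) + sum (λ k → f k * l k) * b
      + (a * sum (λ k → g k * h k) + a * sum (λ k → g k * l k) * b)
  sum-bilinear f g h l a b = begin
    sum (λ k → (f k + a * g k) * (h k + l k * b))
      ≡⟨ sum-cong-≗ (λ k → solve 6 (λ f g h l a b →
           (f :+ a :* g) :* (h :+ l :* b) :=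
           (f :* h :+ (f :* l) :* b) :+ a :* (g :* h :+ (g :* l) :* b)) refl (f k) (g k) (h k) (l k) a b) ⟩
    sum (λ k → (f k * h k + f k * l k * b) + a * (g k * h k + g k * l k * b))
      ≡⟨ ∑-distrib-+ (λ k → f k * h k + f k * l k * b) (λ k → a * (g k * h k + g k * l k * b)) ⟩
    sum (λ k → f k * h k + f k * l k * b) + sum (λ k → a * (g k * h k + g k * l k * b))
      ≡⟨ cong₂ _+_ (half f) (trans (sym (*-distribˡ-sum a (λ k → g k * h k + g k * l k * b))) (cong (a *_) (half g))) ⟩
    fh + fl * b + a * (gh + gl * b)
      ≡⟨ solve 6 (λ fh fl gh gl a b → fh :+ fl :* b :+ a :* (gh :+ gl :* b) :=
           fh :+ fl :* b :+ (a :* gh :+ a :* gl :* b)) refl fh fl gh gl a b ⟩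
    fh + fl * b + (a * gh + a * gl * b) ∎
    where
    fh = sum (λ k → f k * h k)
    fl = sum (λ k → f k * l k)
    gh = sum (λ k → g k * h k)
    gl = sum (λ k → g k * l k)
    half : ∀ f → sum (λ k → f k * h k + f k * l k * b) ≡ sum (λ k → f k * h k) + sum (λ k → f k * l k) * b
    half f = trans (∑-distrib-+ (λ k → f k * h k) (λ k → f k * l k * b))
      (cong (sum (λ k → f k * h k) +_) (sym (*-distribʳ-sum b (λ k → f k * l k))))

  -- Left multiplication by `1 + d eᵢⱼ`; the factor `δ r i` confines the change to row `i` without a
  -- case distinction.
  shear : ∀ {n} → Fin n → Fin n → Carrier → Matrix F n → Matrix F n
  shear i j d X = matrix λ r k → entry F X r k + δ r i * d * entry F X j k

  module _ {n : ℕ} {i j : Fin n} (j≢i : j ≢ i) (d : Carrier) where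

    shear-invertible : (X : Matrix F n) → Invertible F X → Invertible F (shear i j d X)
    shear-invertible X (Y , XY≡1 , YX≡1) = matrix Y′ , product⇐ X′ Y′ right , product⇐ Y′ X′ left
      where
      -- (1 + d eᵢⱼ)X has inverse Y(1 − d eᵢⱼ).
      X′ Y′ : Fin n → Fin n → Carrier
      X′ r k = entry F X r k + δ r i * d * entry F X j k
      Y′ k s = entry F Y k s + entry F Y k i * (- d * δ j s)

      cancel : ∀ x y z → y + z ≡ 0# → x + y + (z + 0#) ≡ x
      cancel x y z eq = trans (cong ((x + y) +_) (+-identityʳ z))
        (trans (+-assoc x y z) (trans (cong (x +_) eq) (+-identityʳ x)))

      opposite : ∀ x y → x * (- d * y) + x * d * y ≡ 0#
      opposite x y = begin
        x * (- d * y) + x * d * y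
          ≡⟨ solve 4 (λ x y d e → x :* (e :* y) :+ x :* d :* y := (e :+ d) :* (x :* y)) refl x y d (- d) ⟩
        (- d + d) * (x * y) ≡⟨ cong (_* (x * y)) (-‿inverseˡ d) ⟩
        0# * (x * y)        ≡⟨ zeroˡ (x * y) ⟩
        0#                  ∎

      -- The quadratic term, a multiple of `eᵢⱼ²`, which is zero because `j ≢ i`.
      vanish : ∀ a b → a * δ j i * b ≡ 0#
      vanish a b = trans (cong (λ z → a * z * b) (δ≡0 j≢i)) (trans (cong (_* b) (zeroʳ a)) (zeroˡ b))

      right : ∀ r s → sum (λ k → X′ r k * Y′ k s) ≡ δ r s
      right r s = begin
        sum (λ k → X′ r k * Y′ k s)
          ≡⟨ sum-bilinear (entry F X r) (entry F X j) (λ k → entry F Y k s) (λ k → entry F Y k i)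
               (δ r i * d) (- d * δ j s) ⟩
        _ ≡⟨ cong₂ _+_
               (cong₂ (λ x y → x + y * (- d * δ j s)) (product⇒ X Y XY≡1 r s) (product⇒ X Y XY≡1 r i))
               (cong₂ (λ x y → δ r i * d * x + δ r i * d * y * (- d * δ j s))
                 (product⇒ X Y XY≡1 j s) (product⇒ X Y XY≡1 j i)) ⟩
        δ r s + δ r i * (- d * δ j s) + (δ r i * d * δ j s + δ r i * d * δ j i * (- d * δ j s))
          ≡⟨ cong (λ z → δ r s + δ r i * (- d * δ j s) + (δ r i * d * δ j s + z)) (vanish _ _) ⟩
        δ r s + δ r i * (- d * δ j s) + (δ r i * d * δ j s + 0#)
          ≡⟨ cancel _ _ _ (opposite (δ r i) (δ j s)) ⟩
        δ r s ∎

      left : ∀ r s → sum (λ k → Y′ r k * X′ k s) ≡ δ r s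
      left r s = begin
        sum (λ k → Y′ r k * X′ k s)
          -- Reassociated to fit `sum-bilinear`: row `r` of `Y` is perturbed along `δ j` by
          -- `y * - d`, column `s` of `X` along `λ k → δ k i` by `d * x`.
          ≡⟨ sum-cong-≗ (λ k → cong₂ (λ x y → (entry F Y r k + x) * (entry F X k s + y))
               (sym (*-assoc y (- d) (δ j k))) (*-assoc (δ k i) d x)) ⟩
        sum (λ k → (entry F Y r k + y * - d * δ j k) * (entry F X k s + δ k i * (d * x)))
          ≡⟨ sum-bilinear (entry F Y r) (δ j) (λ k → entry F X k s) (λ k → δ k i) (y * - d) (d * x) ⟩
        _ ≡⟨ cong₂ _+_
               (cong₂ (λ u v → u + v * (d * x)) (product⇒ Y X YX≡1 r s) (sum-δʳ (entry F Y r) i))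
               (cong₂ (λ u v → y * - d * u + y * - d * v * (d * x))
                 (sum-δˡ (λ k → entry F X k s) j) (sum-δʳ (δ j) i)) ⟩
        δ r s + y * (d * x) + (y * - d * x + y * - d * δ j i * (d * x))
          ≡⟨ cong (λ z → δ r s + y * (d * x) + (y * - d * x + z)) (vanish _ _) ⟩
        δ r s + y * (d * x) + (y * - d * x + 0#)
          ≡⟨ cancel _ _ _ (trans
               (solve 4 (λ x y d e → y :* (d :* x) :+ y :* e :* x := y :* (e :* x) :+ y :* d :* x) refl x y d (- d))
               (opposite y x)) ⟩
        δ r s ∎
        where
        x = entry F X j s
        y = entry F Y r i

    shear-row : (X : Matrix F n) {r : Fin n} → r ≢ i → lookup (shear i j d X) r ≡ lookup X r
    shear-row X {r} r≢i = lookup-ext λ k → begin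
      entry F (shear i j d X) r k
        ≡⟨ entry-matrix (λ r k → entry F X r k + δ r i * d * entry F X j k) r k ⟩
      entry F X r k + δ r i * d * entry F X j k
        ≡⟨ cong (λ z → entry F X r k + z * d * entry F X j k) (δ≡0 r≢i) ⟩
      entry F X r k + 0# * d * entry F X j k
        ≡⟨ cong (λ z → entry F X r k + z) (trans (cong (_* entry F X j k) (zeroˡ d)) (zeroˡ _)) ⟩
      entry F X r k + 0#  ≡⟨ +-identityʳ _ ⟩
      entry F X r k       ∎

    -- `U · X` is a sum over rows, and only the summand of row `i` changes.
    shear-· : (U X : Matrix F n) → _·_ F U (shear i j d X) ≡ _·_ F U X + d * dot (lookup U i) (lookup X j)
    shear-· U X = begin
      sum (λ r → dot (lookup U r) (lookup (shear i j d X) r))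
        ≡⟨ sum-cong-≗ (λ r → row r) ⟩
      sum (λ r → dot (lookup U r) (lookup X r) + d * dot (lookup U r) (lookup X j) * δ r i)
        ≡⟨ ∑-distrib-+ (λ r → dot (lookup U r) (lookup X r)) (λ r → d * dot (lookup U r) (lookup X j) * δ r i) ⟩
      _·_ F U X + sum (λ r → d * dot (lookup U r) (lookup X j) * δ r i)
        ≡⟨ cong (_·_ F U X +_) (sum-δʳ (λ r → d * dot (lookup U r) (lookup X j)) i) ⟩
      _·_ F U X + d * dot (lookup U i) (lookup X j) ∎
      where
      row : ∀ r → dot (lookup U r) (lookup (shear i j d X) r) ≡
        dot (lookup U r) (lookup X r) + d * dot (lookup U r) (lookup X j) * δ r i
      row r = begin
        sum (λ k → entry F U r k * entry F (shear i j d X) r k)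
          ≡⟨ sum-cong-≗ (λ k → trans
               (cong (entry F U r k *_) (entry-matrix (λ r k → entry F X r k + δ r i * d * entry F X j k) r k))
               (solve 5 (λ u x e d y → u :* (x :+ e :* d :* y) := u :* x :+ d :* e :* (u :* y)) refl
                  (entry F U r k) (entry F X r k) (δ r i) d (entry F X j k))) ⟩
        sum (λ k → entry F U r k * entry F X r k + d * δ r i * (entry F U r k * entry F X j k))
          ≡⟨ ∑-distrib-+ (λ k → entry F U r k * entry F X r k) (λ k → d * δ r i * (entry F U r k * entry F X j k)) ⟩
        dot (lookup U r) (lookup X r) + sum (λ k → d * δ r i * (entry F U r k * entry F X j k))
          ≡⟨ cong (dot (lookup U r) (lookup X r) +_)
               (sym (*-distribˡ-sum (d * δ r i) (λ k → entry F U r k * entry F X j k))) ⟩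
        dot (lookup U r) (lookup X r) + d * δ r i * dot (lookup U r) (lookup X j)
          ≡⟨ cong (dot (lookup U r) (lookup X r) +_)
               (solve 3 (λ d e s → d :* e :* s := d :* s :* e) refl d (δ r i) (dot (lookup U r) (lookup X j))) ⟩
        dot (lookup U r) (lookup X r) + d * dot (lookup U r) (lookup X j) * δ r i ∎

    shear-inverse : (X : Matrix F n) → shear i j (- d) (shear i j d X) ≡ X
    shear-inverse X = matrix-ext λ r k → begin
      entry F (shear i j (- d) (shear i j d X)) r k
        ≡⟨ entry-matrix (λ r k → entry F (shear i j d X) r k + δ r i * - d * entry F (shear i j d X) j k) r k ⟩
      entry F (shear i j d X) r k + δ r i * - d * entry F (shear i j d X) j k
        ≡⟨ cong₂ (λ x y → x + δ r i * - d * y)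
             (entry-matrix (λ r k → entry F X r k + δ r i * d * entry F X j k) r k)
             -- The second operation reads row `j`, which the first has left alone.
             (cong (λ v → lookup v k) (shear-row X j≢i)) ⟩
      entry F X r k + δ r i * d * entry F X j k + δ r i * - d * entry F X j k
        ≡⟨ solve 5 (λ x e d c y → x :+ e :* d :* y :+ e :* c :* y := x :+ e :* (d :+ c) :* y) refl
             (entry F X r k) (δ r i) d (- d) (entry F X j k) ⟩
      entry F X r k + δ r i * (d + - d) * entry F X j k
        ≡⟨ cong (λ z → entry F X r k + δ r i * z * entry F X j k) (-‿inverseʳ d) ⟩
      entry F X r k + δ r i * 0# * entry F X j k
        ≡⟨ cong (entry F X r k +_) (trans (cong (_* entry F X j k) (zeroʳ _)) (zeroˡ _)) ⟩
      entry F X r k + 0#  ≡⟨ +-identityʳ _ ⟩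
      entry F X r k       ∎

-- Comparing lengths of duplicate-free lists.

remove-∈ : ∀ {A : Set} {y : A} {ys} → y ∈ ys →
  ∃ λ zs → length ys ≡ suc (length zs) × (∀ {z} → z ∈ ys → z ≢ y → z ∈ zs)
remove-∈ {ys = y ∷ ys} (here refl) = ys , refl , λ where
  (here z≡y)  z≢y → contradiction z≡y z≢y
  (there z∈ys) _  → z∈ys
remove-∈ {ys = x ∷ ys} (there y∈ys) = let zs , eq , keep = remove-∈ y∈ys in
  x ∷ zs , cong suc eq , λ where
    (here z≡x)   _   → here z≡x
    (there z∈ys) z≢y → there (keep z∈ys z≢y)

-- The pigeonhole principle: the image of the head is struck from `ys`, and uniqueness with
-- injectivity keeps the images of the tail in what remains. Injectivity is asked only on members of
-- `xs`, since dropping a column is injective only within one fibre and among matrices without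
-- pivot.
injection⇒≤ : ∀ {A B : Set} (f : A → B) {xs} ys → Unique xs → (∀ {x} → x ∈ xs → f x ∈ ys) →
  (∀ {x x′} → x ∈ xs → x′ ∈ xs → f x ≡ f x′ → x ≡ x′) → length xs ≤ length ys
injection⇒≤ f ys []            into inj = z≤n
injection⇒≤ f ys (x∉xs ∷ uniq) into inj = let zs , eq , keep = remove-∈ (into (here refl)) in
  subst (_ ≤_) (sym eq) (s≤s (injection⇒≤ f zs uniq
    (λ x′∈xs → keep (into (there x′∈xs))
      (λ fx′≡fx → All.lookup x∉xs x′∈xs (inj (here refl) (there x′∈xs) (sym fx′≡fx))))
    (λ x∈xs x′∈xs → inj (there x∈xs) (there x′∈xs))))

length-split : ∀ {A : Set} {P : A → Set} (P? : Decidable P) xs →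
  length xs ≡ length (filter P? xs) ℕ.+ length (filter (¬? ∘ P?) xs)
length-split P? []       = refl
length-split P? (x ∷ xs) with P? x
... | yes _ = cong suc (length-split P? xs)
... | no  _ = trans (cong suc (length-split P? xs)) (sym (ℕ.+-suc _ _))

length-cartesianProductWith : ∀ {A B C : Set} (f : A → B → C) xs ys →
  length (cartesianProductWith f xs ys) ≡ length xs ℕ.* length ys
length-cartesianProductWith f []       ys = refl
length-cartesianProductWith f (x ∷ xs) ys = trans
  (length-++ (map (f x) ys))
  (cong₂ ℕ._+_ (length-map (f x) ys) (length-cartesianProductWith f xs ys))

length-vectors : ∀ {A : Set} (xs : List A) n → length (vectors xs n) ≡ length xs ^ n
length-vectors xs zero    = refl
length-vectors xs (suc n) = trans (length-cartesianProductWith _∷_ xs (vectors xs n))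
  (cong (length xs ℕ.*_) (length-vectors xs n))

vectors-unique : ∀ {A : Set} {xs : List A} → Unique xs → ∀ n → Unique (vectors xs n)
vectors-unique uniq zero    = All.[] ∷ []
vectors-unique uniq (suc n) = Unique.cartesianProductWith⁺ _∷_ Vec.∷-injective uniq (vectors-unique uniq n)

-- The fibres of `X ↦ U · X` on the general linear group.

module Counting {q : ℕ} (F : FiniteField q) where
  open FiniteField F
  open LinearAlgebra F
  open CommutativeRing commutativeRing using
    (ring; +-assoc; +-comm; +-identityʳ; -‿inverseˡ; *-assoc; *-comm; *-identityʳ; zeroʳ)
  open RingProperties ring using (-‿distribˡ-*)

  elements-unique : Unique elements
  elements-unique = Unique.map⁺ element-injective (Unique.allFin⁺ q)
    where
    element-injective : ∀ {i j} → element i ≡ element j → i ≡ j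
    element-injective {i} {j} eq = trans (sym (Inverse.inverseʳ enumeration refl))
      (trans (cong index eq) (Inverse.inverseʳ enumeration refl))

  length-elements : length elements ≡ q
  length-elements = trans (length-map element (List.allFin q)) (length-tabulate id)

  GL-unique : ∀ n → Unique (GL F n)
  GL-unique n = Unique.filter⁺ (invertible? F) (vectors-unique (vectors-unique elements-unique n) n)

  ∈-GL : ∀ {n} {X : Matrix F n} → Invertible F X → X ∈ GL F n
  ∈-GL {X = X} = ∈-filter⁺ (invertible? F) (∈-matrices F X)

  level : ∀ {n} → Matrix F n → Carrier → List (Matrix F n)
  level {n} U a = filter (λ X → _·_ F U X ≟ a) (GL F n)

  level-unique : ∀ {n} (U : Matrix F n) a → Unique (level U a)
  level-unique {n} U a = Unique.filter⁺ (λ X → _·_ F U X ≟ a) (GL-unique n)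

  ∈-level⁺ : ∀ {n} (U : Matrix F n) {X} {a} → Invertible F X → _·_ F U X ≡ a → X ∈ level U a
  ∈-level⁺ U inv = ∈-filter⁺ (λ X → _·_ F U X ≟ _) (∈-GL inv)

  ∈-level⁻ : ∀ {n} (U : Matrix F n) {X} {a} → X ∈ level U a → Invertible F X × _·_ F U X ≡ a
  ∈-level⁻ {n} U X∈ = let X∈GL , eq = ∈-filter⁻ (λ X → _·_ F U X ≟ _) {xs = GL F n} X∈ in
    proj₂ (∈-filter⁻ (invertible? F) {xs = matrices F n} X∈GL) , eq

  level-scale-≤ : ∀ {n} (U : Matrix F n) {c} → c ≢ 0# → ∀ a →
    length (level U a) ≤ length (level U (c * a))
  level-scale-≤ U {c} c≢0 a = injection⇒≤ (scale c) (level U (c * a)) (level-unique U a)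
    (λ {X} X∈ → let inv , eq = ∈-level⁻ U X∈ in
      ∈-level⁺ U (scale-invertible c≢0 X inv) (trans (scale-· c U X) (cong (c *_) eq)))
    (λ {X} {Y} _ _ eq → let d , cd≡1 = inverse c c≢0 in
      trans (sym (scale-inverse (trans (*-comm d c) cd≡1) X))
        (trans (cong (scale d) eq) (scale-inverse (trans (*-comm d c) cd≡1) Y)))

  inverse-nonzero : ∀ {a b} → a * b ≡ 1# → b ≢ 0#
  inverse-nonzero {a} ab≡1 b≡0 = 0≢1 (trans (sym (zeroʳ a)) (trans (cong (a *_) (sym b≡0)) ab≡1))

  -- Scaling by `a⁻¹` carries the fibre over `a` into the one over `1#`, and scaling by `a` carries
  -- it back.
  length-level : ∀ {n} (U : Matrix F n) {a} → a ≢ 0# → length (level U a) ≡ length (level U 1#)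
  length-level U {a} a≢0 = let b , ab≡1 = inverse a a≢0 in ℕ.≤-antisym
    (subst (λ c → length (level U a) ≤ length (level U c)) (trans (*-comm b a) ab≡1)
      (level-scale-≤ U (inverse-nonzero ab≡1) a))
    (subst (λ c → length (level U 1#) ≤ length (level U c)) (*-identityʳ a) (level-scale-≤ U a≢0 1#))

  -- Equality in `F` is decidable and there are finitely many positions, so a search turns the
  -- negation into a witness.
  nonzero-entry : ∀ {n} {U : Matrix F n} → U ≢ 0ᴹ F → ∃₂ λ i k → entry F U i k ≢ 0#
  nonzero-entry {n} {U} U≢0 = decidable-stable
    (Fin.any? λ i → Fin.any? λ k → ¬? (entry F U i k ≟ 0#))
    λ none → U≢0 (matrix-ext λ i k → trans
      (decidable-stable (entry F U i k ≟ 0#) λ nz → none (i , k , nz))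
      (sym (trans (cong (λ v → lookup v k) (Vec.lookup-replicate i (Vec.replicate n 0#))) (Vec.lookup-replicate k 0#))))

  -- The linear equation can be solved for coordinate `k`, whose coefficient is invertible.
  dot-determines : ∀ {n} {u x y : Vec Carrier n} {k} → lookup u k ≢ 0# →
    (∀ l → l ≢ k → lookup x l ≡ lookup y l) → dot u x ≡ dot u y → x ≡ y
  dot-determines {u = u} {x} {y} {k} uk≢0 agree eq = lookup-ext agree-everywhere
    where
    agree-everywhere : ∀ l → lookup x l ≡ lookup y l
    agree-everywhere l with l Fin.≟ k
    ... | no  l≢k  = agree l l≢k
    ... | yes refl = *-cancelˡ uk≢0 (sum-determines k (λ l → lookup u l * lookup x l) (λ l → lookup u l * lookup y l)
                       (λ l l≢k → cong (lookup u l *_) (agree l l≢k)) eq)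

  module _ {m : ℕ} (U : Matrix F (suc m)) (i k : Fin (suc m)) (Uik≢0 : entry F U i k ≢ 0#) where

    -- Adding e times row punchIn i l to row i adds e times the l-th slope to U · X,
    -- and leaves the slopes unchanged.
    slopes : Matrix F (suc m) → Vec Carrier m
    slopes X = tabulate λ l → dot (lookup U i) (lookup X (punchIn i l))

    Pivot : Vec Carrier m → Set
    Pivot c = ∃ λ l → lookup c l ≢ 0#

    pivot? : Decidable Pivot
    pivot? c = Fin.any? λ l → ¬? (lookup c l ≟ 0#)

    -- The row is selected from a separate vector `c`, later `slopes X`, so that the maps for `t`
    -- and `- t` with the same `c` visibly select the same row. The multiple `t / cₗ` makes the
    -- change of `U · X` equal to `t`. Without a pivot the default is the identity, which keeps
    -- invertibility and reversibility true in all cases.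
    transvection : Vec Carrier m → Carrier → Matrix F (suc m) → Matrix F (suc m)
    transvection c t X with pivot? c
    ... | yes (l , cl≢0) = shear i (punchIn i l) (t * proj₁ (inverse (lookup c l) cl≢0)) X
    ... | no  _          = X

    -- The slopes read only rows other than `i`, and only row `i` is altered.
    slopes-transvection : ∀ c t X → slopes (transvection c t X) ≡ slopes X
    slopes-transvection c t X with pivot? c
    ... | yes (l , _) = Vec.tabulate-cong λ r → cong (dot (lookup U i))
                          (shear-row (Fin.punchInᵢ≢i i l) _ X (Fin.punchInᵢ≢i i r))
    ... | no  _       = refl

    transvection-invertible : ∀ c t X → Invertible F X → Invertible F (transvection c t X)
    transvection-invertible c t X inv with pivot? c
    ... | yes (l , _) = shear-invertible (Fin.punchInᵢ≢i i l) _ X inv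
    ... | no  _       = inv

    transvection-inverse : ∀ c t X → transvection c (- t) (transvection c t X) ≡ X
    transvection-inverse c t X with pivot? c
    ... | yes (l , cl≢0) = let s = t * proj₁ (inverse (lookup c l) cl≢0) in trans
      (cong (λ e → shear i (punchIn i l) e (shear i (punchIn i l) s X)) (sym (-‿distribˡ-* t _)))
      (shear-inverse (Fin.punchInᵢ≢i i l) s X)
    ... | no  _          = refl

    transvection-· : ∀ t X → Pivot (slopes X) → _·_ F U (transvection (slopes X) t X) ≡ _·_ F U X + t
    transvection-· t X pivot with pivot? (slopes X)
    ... | no ¬pivot      = contradiction pivot ¬pivot
    ... | yes (l , cl≢0) = let d , cd≡1 = inverse (lookup (slopes X) l) cl≢0 in
      trans (shear-· (Fin.punchInᵢ≢i i l) (t * d) U X) (cong (_·_ F U X +_)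
        (trans (cong (t * d *_) (sym (Vec.lookup∘tabulate (λ l → dot (lookup U i) (lookup X (punchIn i l))) l)))
        (trans (*-assoc t d _) (trans (cong (t *_) (trans (*-comm d _) cd≡1)) (*-identityʳ t)))))

    translate : Carrier → Matrix F (suc m) → Matrix F (suc m)
    translate t X = transvection (slopes X) t X

    translate-inverse : ∀ t X → translate (- t) (translate t X) ≡ X
    translate-inverse t X = trans
      -- The image has the slopes of `X`, so the way back uses the same pivot.
      (cong (λ c → transvection c (- t) (translate t X)) (slopes-transvection (slopes X) t X))
      (transvection-inverse (slopes X) t X)

    pivotal? : Decidable (Pivot ∘ slopes)
    pivotal? X = pivot? (slopes X)

    -- Translation by `b - a`. Comparing with the whole fibre over `b` is enough for `level-close`,
    -- which is applied in both directions.
    pivotal-≤ : ∀ a b → length (filter pivotal? (level U a)) ≤ length (level U b)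
    pivotal-≤ a b = injection⇒≤ (translate (b + - a)) (level U b) (Unique.filter⁺ pivotal? (level-unique U a))
      (λ {X} X∈ → let X∈level , pivot = ∈-filter⁻ pivotal? {xs = level U a} X∈
                      inv , eq = ∈-level⁻ U X∈level in
        ∈-level⁺ U (transvection-invertible (slopes X) _ X inv)
          (trans (transvection-· _ X pivot) (trans (cong (_+ (b + - a)) eq)
            (trans (+-comm a (b + - a)) (trans (+-assoc b (- a) a)
              (trans (cong (b +_) (-‿inverseˡ a)) (+-identityʳ b)))))))
      (λ {X} {Y} _ _ eq → trans (sym (translate-inverse _ X))
        (trans (cong (translate _) eq) (translate-inverse _ Y)))

    ¬pivot⇒orthogonal : ∀ {X} → ¬ Pivot (slopes X) → ∀ {r} → r ≢ i → dot (lookup U i) (lookup X r) ≡ 0#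
    ¬pivot⇒orthogonal {X} ¬pivot {r} r≢i = let i≢r = r≢i ∘ sym in trans
      (cong (λ r → dot (lookup U i) (lookup X r)) (sym (Fin.punchIn-punchOut i≢r)))
      (trans (sym (Vec.lookup∘tabulate (λ l → dot (lookup U i) (lookup X (punchIn i l))) (punchOut i≢r)))
        (decidable-stable (_ ≟ 0#) λ nz → ¬pivot (punchOut i≢r , nz)))

    -- Without a pivot, each row of X other than i satisfies a linear equation in which the
    -- coefficient of column k is nonzero, and row i satisfies one once U · X is known.
    dropColumn : Matrix F (suc m) → Vec (Vec Carrier m) (suc m)
    dropColumn = Vec.map (λ v → removeAt v k)

    dropColumn-agree : ∀ {X Y} → dropColumn X ≡ dropColumn Y →
      ∀ r l → l ≢ k → entry F X r l ≡ entry F Y r l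
    dropColumn-agree {X} {Y} eq r l l≢k = trans (sym (expand X)) (trans
      (cong (λ Z → lookup (lookup Z r) (punchOut k≢l)) eq) (expand Y))
      where
      k≢l = l≢k ∘ sym
      expand : ∀ X → lookup (lookup (dropColumn X) r) (punchOut k≢l) ≡ entry F X r l
      expand X = trans (cong (λ v → lookup v (punchOut k≢l)) (Vec.lookup-map r (λ v → removeAt v k) X))
        (Vec.removeAt-punchOut (lookup X r) k≢l)

    dropColumn-injective : ∀ {X Y} → ¬ Pivot (slopes X) → ¬ Pivot (slopes Y) → _·_ F U X ≡ _·_ F U Y →
      dropColumn X ≡ dropColumn Y → X ≡ Y
    dropColumn-injective {X} {Y} ¬pX ¬pY U·X≡U·Y eq = lookup-ext rows
      where
      other-rows : ∀ r → r ≢ i → lookup X r ≡ lookup Y r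
      other-rows r r≢i = dot-determines {u = lookup U i} Uik≢0 (dropColumn-agree eq r)
        (trans (¬pivot⇒orthogonal {X} ¬pX r≢i) (sym (¬pivot⇒orthogonal {Y} ¬pY r≢i)))

      rows : ∀ r → lookup X r ≡ lookup Y r
      rows r with r Fin.≟ i
      ... | no  r≢i  = other-rows r r≢i
      -- The other rows agree already, so `U · X ≡ U · Y` reduces to an equation for the product
      -- with row `i` of `U`.
      ... | yes refl = dot-determines {u = lookup U i} Uik≢0 (dropColumn-agree eq i)
        (sum-determines i (λ r → dot (lookup U r) (lookup X r)) (λ r → dot (lookup U r) (lookup Y r))
          (λ r r≢i → cong (dot (lookup U r)) (other-rows r r≢i)) U·X≡U·Y)

    -- For `m = 0` there are no slopes: every matrix of the fibre is counted here, and the bound is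
    -- `1`.
    nonpivotal-≤ : ∀ a → length (filter (¬? ∘ pivotal?) (level U a)) ≤ q ^ (suc m ℕ.* suc m ∸ suc m)
    nonpivotal-≤ a = subst (length (filter (¬? ∘ pivotal?) (level U a)) ≤_) size
      (injection⇒≤ dropColumn (vectors (vectors elements m) (suc m))
        (Unique.filter⁺ (¬? ∘ pivotal?) (level-unique U a))
        (λ _ → ∈-vectors (∈-vectors ∈-elements) _)
        (λ X∈ Y∈ → let X∈level , ¬pX = ∈-filter⁻ (¬? ∘ pivotal?) {xs = level U a} X∈
                       Y∈level , ¬pY = ∈-filter⁻ (¬? ∘ pivotal?) {xs = level U a} Y∈ in
          dropColumn-injective ¬pX ¬pY (trans (proj₂ (∈-level⁻ U X∈level)) (sym (proj₂ (∈-level⁻ U Y∈level))))))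
      where
      open ≡-Reasoning
      size : length (vectors (vectors elements m) (suc m)) ≡ q ^ (suc m ℕ.* suc m ∸ suc m)
      size = begin
        length (vectors (vectors elements m) (suc m)) ≡⟨ length-vectors (vectors elements m) (suc m) ⟩
        length (vectors elements m) ^ suc m           ≡⟨ cong (_^ suc m) (length-vectors elements m) ⟩
        (length elements ^ m) ^ suc m                 ≡⟨ ℕ.^-*-assoc (length elements) m (suc m) ⟩
        -- `suc m * suc m` unfolds to `suc m + m * suc m`, so the truncated subtraction loses
        -- nothing.
        length elements ^ (m ℕ.* suc m)               ≡⟨ cong₂ _^_ length-elements (sym (ℕ.m+n∸m≡n (suc m) (m ℕ.* suc m))) ⟩
        q ^ (suc m ℕ.* suc m ∸ suc m)                 ∎

    level-close : ∀ a b → length (level U a) ≤ length (level U b) ℕ.+ q ^ (suc m ℕ.* suc m ∸ suc m)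
    level-close a b = subst (_≤ length (level U b) ℕ.+ q ^ (suc m ℕ.* suc m ∸ suc m))
      (sym (length-split pivotal? (level U a)))
      (ℕ.+-mono-≤ (pivotal-≤ a b) (nonpivotal-≤ a))

-- Squares of rationals.

open +-*-Solver using (solve; _:+_; _:*_; _:-_; :-_; _:=_; con)

0<square : ∀ {ε} → 0ℚ ℚ.< ε → 0ℚ ℚ.< ε ℚ.* ε
0<square {ε} 0<ε = ℚ.positive⁻¹ (ε ℚ.* ε) {{ℚ.pos*pos⇒pos ε {{ℚ.positive 0<ε}} ε {{ℚ.positive 0<ε}}}}

square-mono-≤ : ∀ {p r} → 0ℚ ℚ.≤ p → p ℚ.≤ r → p ℚ.* p ℚ.≤ r ℚ.* r
square-mono-≤ {p} {r} 0≤p p≤r = ℚ.≤-trans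
  (ℚ.*-monoˡ-≤-nonNeg p {{ℚ.nonNegative 0≤p}} p≤r)
  (ℚ.*-monoʳ-≤-nonNeg r {{ℚ.nonNegative (ℚ.≤-trans 0≤p p≤r)}} p≤r)

square-mono-< : ∀ {p r} → 0ℚ ℚ.≤ p → p ℚ.< r → p ℚ.* p ℚ.< r ℚ.* r
square-mono-< {p} {r} 0≤p p<r = ℚ.≤-<-trans
  (ℚ.*-monoˡ-≤-nonNeg p {{ℚ.nonNegative 0≤p}} (ℚ.<⇒≤ p<r))
  (ℚ.*-monoˡ-<-pos r {{ℚ.positive (ℚ.≤-<-trans 0≤p p<r)}} p<r)

square-abs : ∀ p → ℚ.∣ p ∣ ℚ.* ℚ.∣ p ∣ ≡ p ℚ.* p
square-abs p with ℚ.∣p∣≡p∨∣p∣≡-p p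
... | inj₁ eq = cong₂ ℚ._*_ eq eq
... | inj₂ eq = trans (cong₂ ℚ._*_ eq eq) (solve 1 (λ p → (:- p) :* (:- p) := p :* p) refl p)

0≤square : ∀ p → 0ℚ ℚ.≤ p ℚ.* p
0≤square p = subst₂ ℚ._≤_ (ℚ.*-zeroˡ 0ℚ) (square-abs p) (square-mono-≤ ℚ.≤-refl (ℚ.0≤∣p∣ p))

-- Equality, cancellation and square roots of real numbers.

-- Arithmetic is termwise, so ring identities for real and complex numbers reduce through this to
-- identities of rationals.
≈ℝ-pointwise : ∀ {x y} → (∀ n → seq x n ≡ seq y n) → x ≈ℝ y
≈ℝ-pointwise {x} {y} eq ε 0<ε = 0 , λ n _ → subst (λ z → ℚ.∣ z ∣ ℚ.< ε)
  (sym (trans (cong (ℚ._- seq y n) (eq n)) (ℚ.+-inverseʳ (seq y n)))) 0<ε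

≈ℝ-refl : ∀ {x} → x ≈ℝ x
≈ℝ-refl {x} = ≈ℝ-pointwise {x} {x} λ _ → refl

≈ℝ-sym : ∀ {x y} → x ≈ℝ y → y ≈ℝ x
≈ℝ-sym {x} {y} x≈y ε 0<ε = let N , h = x≈y ε 0<ε in
  N , λ n N≤n → subst (ℚ._< ε) (abs-swap (seq x n) (seq y n)) (h n N≤n)

≈ℝ-trans : ∀ {x y z} → x ≈ℝ y → y ≈ℝ z → x ≈ℝ z
≈ℝ-trans {x} {y} {z} x≈y y≈z ε 0<ε =
  let M , g = x≈y (ε ℚ.* ½) (half-pos 0<ε)
      N , h = y≈z (ε ℚ.* ½) (half-pos 0<ε)
  in M ℕ.⊔ N , λ n K≤n → begin-strict
    ℚ.∣ seq x n ℚ.- seq z n ∣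
      ≡⟨ cong ℚ.∣_∣ (solve 3 (λ x y z → x :- z := (x :- y) :+ (y :- z)) refl (seq x n) (seq y n) (seq z n)) ⟩
    ℚ.∣ (seq x n ℚ.- seq y n) ℚ.+ (seq y n ℚ.- seq z n) ∣
      ≤⟨ ℚ.∣p+q∣≤∣p∣+∣q∣ (seq x n ℚ.- seq y n) (seq y n ℚ.- seq z n) ⟩
    ℚ.∣ seq x n ℚ.- seq y n ∣ ℚ.+ ℚ.∣ seq y n ℚ.- seq z n ∣
      <⟨ ℚ.+-mono-< (g n (ℕ.m⊔n≤o⇒m≤o M N K≤n)) (h n (ℕ.m⊔n≤o⇒n≤o M N K≤n)) ⟩
    ε ℚ.* ½ ℚ.+ ε ℚ.* ½  ≡⟨ half+half ε ⟩
    ε ∎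
  where open ℚ.≤-Reasoning

+ℝ-cong : ∀ {x x′ y y′} → x ≈ℝ x′ → y ≈ℝ y′ → x +ℝ y ≈ℝ x′ +ℝ y′
+ℝ-cong {x} {x′} {y} {y′} x≈x′ y≈y′ ε 0<ε =
  let M , g = x≈x′ (ε ℚ.* ½) (half-pos 0<ε)
      N , h = y≈y′ (ε ℚ.* ½) (half-pos 0<ε)
  in M ℕ.⊔ N , λ n K≤n → begin-strict
    ℚ.∣ (seq x n ℚ.+ seq y n) ℚ.- (seq x′ n ℚ.+ seq y′ n) ∣
      ≡⟨ cong ℚ.∣_∣ (solve 4 (λ a b c d → (a :+ b) :- (c :+ d) := (a :- c) :+ (b :- d)) refl
                       (seq x n) (seq y n) (seq x′ n) (seq y′ n)) ⟩
    ℚ.∣ (seq x n ℚ.- seq x′ n) ℚ.+ (seq y n ℚ.- seq y′ n) ∣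
      ≤⟨ ℚ.∣p+q∣≤∣p∣+∣q∣ (seq x n ℚ.- seq x′ n) (seq y n ℚ.- seq y′ n) ⟩
    ℚ.∣ seq x n ℚ.- seq x′ n ∣ ℚ.+ ℚ.∣ seq y n ℚ.- seq y′ n ∣
      <⟨ ℚ.+-mono-< (g n (ℕ.m⊔n≤o⇒m≤o M N K≤n)) (h n (ℕ.m⊔n≤o⇒n≤o M N K≤n)) ⟩
    ε ℚ.* ½ ℚ.+ ε ℚ.* ½  ≡⟨ half+half ε ⟩
    ε ∎
  where open ℚ.≤-Reasoning

-ℝ-cong : ∀ {x x′} → x ≈ℝ x′ → -ℝ x ≈ℝ -ℝ x′
-ℝ-cong {x} {x′} x≈x′ ε 0<ε = let N , h = ≈ℝ-sym {x} {x′} x≈x′ ε 0<ε in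
  N , λ n N≤n → subst (λ z → ℚ.∣ z ∣ ℚ.< ε)
    (solve 2 (λ a b → b :- a := (:- a) :- (:- b)) refl (seq x n) (seq x′ n)) (h n N≤n)

-- From `x y - x′ y′ = x (y - y′) + y′ (x - x′)`, which is why `x` and `y′` are the two sequences to
-- be bounded.
*ℝ-cong : ∀ {x x′ y y′} → x ≈ℝ x′ → y ≈ℝ y′ → x *ℝ y ≈ℝ x′ *ℝ y′
*ℝ-cong {x} {x′} {y} {y′} x≈x′ y≈y′ ε 0<ε =
  let A , 0<A , M , hA = cauchy⇒bounded (seq x) (cauchy x)
      B , 0<B , N , hB = cauchy⇒bounded (seq y′) (cauchy y′)
      η , 0<η , η-spec = split 0<A 0<B 0<ε
      K₁ , h₁ = x≈x′ η 0<η
      K₂ , h₂ = y≈y′ η 0<η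
      left : ∀ {i} → (M ℕ.⊔ N) ℕ.⊔ (K₁ ℕ.⊔ K₂) ℕ.≤ i → M ℕ.⊔ N ℕ.≤ i
      left = ℕ.m⊔n≤o⇒m≤o (M ℕ.⊔ N) (K₁ ℕ.⊔ K₂)
      right : ∀ {i} → (M ℕ.⊔ N) ℕ.⊔ (K₁ ℕ.⊔ K₂) ℕ.≤ i → K₁ ℕ.⊔ K₂ ℕ.≤ i
      right = ℕ.m⊔n≤o⇒n≤o (M ℕ.⊔ N) (K₁ ℕ.⊔ K₂)
  in (M ℕ.⊔ N) ℕ.⊔ (K₁ ℕ.⊔ K₂) , λ n K≤n →
    subst (ℚ.∣ seq x n ℚ.* seq y n ℚ.- seq x′ n ℚ.* seq y′ n ∣ ℚ.<_) η-spec
      (*-difference-bound 0<A 0<B (seq x n) (seq y n) (seq x′ n) (seq y′ n)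
        (hA n (ℕ.m⊔n≤o⇒m≤o M N (left K≤n))) (hB n (ℕ.m⊔n≤o⇒n≤o M N (left K≤n)))
        (h₂ n (ℕ.m⊔n≤o⇒n≤o K₁ K₂ (right K≤n))) (h₁ n (ℕ.m⊔n≤o⇒m≤o K₁ K₂ (right K≤n))))

-- A constructive substitute for the dichotomy x = 0 or x ≠ 0.
EventuallySmall EventuallyLarge : ℚ → ℝ → Set
EventuallySmall ε x = ∃ λ N → ∀ n → N ℕ.≤ n → ℚ.∣ seq x n ∣ ℚ.< ε
EventuallyLarge η x = ∃ λ N → ∀ n → N ℕ.≤ n → η ℚ.≤ ℚ.∣ seq x n ∣

-- A single rational comparison decides: beyond `N` the sequence varies by less than `ε/4`, so
-- comparing its term at `N` with `ε/2` puts all later terms below `ε` or above `ε/4`.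
small-or-large : ∀ x {ε} → 0ℚ ℚ.< ε → EventuallySmall ε x ⊎ ∃ λ η → 0ℚ ℚ.< η × EventuallyLarge η x
small-or-large x {ε} 0<ε with cauchy x (ε ℚ.* ½ ℚ.* ½) (half-pos (half-pos 0<ε))
... | N , h with ℚ.∣ seq x N ∣ ℚ.<? ε ℚ.* ½
...   | yes xN<ε/2 = inj₁ (N , λ n N≤n → begin-strict
  ℚ.∣ seq x n ∣                              ≤⟨ abs-shift (seq x n) (seq x N) ⟩
  ℚ.∣ seq x N ∣ ℚ.+ ℚ.∣ seq x n ℚ.- seq x N ∣ <⟨ ℚ.+-mono-< xN<ε/2 (h n N N≤n ℕ.≤-refl) ⟩
  ε ℚ.* ½ ℚ.+ ε ℚ.* ½ ℚ.* ½                  ≤⟨ ℚ.+-monoʳ-≤ (ε ℚ.* ½) quarter≤half ⟩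
  ε ℚ.* ½ ℚ.+ ε ℚ.* ½                        ≡⟨ half+half ε ⟩
  ε                                          ∎)
  where
  open ℚ.≤-Reasoning
  quarter≤half : ε ℚ.* ½ ℚ.* ½ ℚ.≤ ε ℚ.* ½
  quarter≤half = begin
    ε ℚ.* ½ ℚ.* ½                        ≡⟨ ℚ.+-identityʳ _ ⟨
    ε ℚ.* ½ ℚ.* ½ ℚ.+ 0ℚ                 ≤⟨ ℚ.+-monoʳ-≤ (ε ℚ.* ½ ℚ.* ½) (ℚ.<⇒≤ (half-pos (half-pos 0<ε))) ⟩
    ε ℚ.* ½ ℚ.* ½ ℚ.+ ε ℚ.* ½ ℚ.* ½      ≡⟨ half+half (ε ℚ.* ½) ⟩
    ε ℚ.* ½                              ∎
...   | no xN≮ε/2 = inj₂ (η , half-pos (half-pos 0<ε) , N , λ n N≤n → ℚ.<⇒≤ (begin-strict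
  η                                             ≡⟨ solve 1 (λ η → η := (η :+ η) :- η) refl η ⟩
  (η ℚ.+ η) ℚ.- η                               ≡⟨ cong (ℚ._- η) (half+half (ε ℚ.* ½)) ⟩
  ε ℚ.* ½ ℚ.- η
    <⟨ <-+⇒-< (ε ℚ.* ½) η ℚ.∣ seq x n ∣ (begin-strict
         ε ℚ.* ½                                      ≤⟨ ℚ.≮⇒≥ xN≮ε/2 ⟩
         ℚ.∣ seq x N ∣                                ≤⟨ abs-shift (seq x N) (seq x n) ⟩
         ℚ.∣ seq x n ∣ ℚ.+ ℚ.∣ seq x N ℚ.- seq x n ∣  <⟨ ℚ.+-monoʳ-< ℚ.∣ seq x n ∣ (h N n ℕ.≤-refl N≤n) ⟩
         ℚ.∣ seq x n ∣ ℚ.+ η                          ≡⟨ ℚ.+-comm ℚ.∣ seq x n ∣ η ⟩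
         η ℚ.+ ℚ.∣ seq x n ∣                          ∎) ⟩
  ℚ.∣ seq x n ∣                                 ∎))
  where
  open ℚ.≤-Reasoning
  η = ε ℚ.* ½ ℚ.* ½

-- The lower bound `η` stands in for a reciprocal of `s`: an error below `ε η` in the products is an
-- error below `ε` in the factors.
*ℝ-cancelʳ : ∀ {x y s η} → 0ℚ ℚ.< η → EventuallyLarge η s → x *ℝ s ≈ℝ y *ℝ s → x ≈ℝ y
*ℝ-cancelʳ {x} {y} {s} {η} 0<η (M , large) xs≈ys ε 0<ε =
  let N , h = xs≈ys (ε ℚ.* η) (ℚ.positive⁻¹ (ε ℚ.* η) {{ℚ.pos*pos⇒pos ε {{ℚ.positive 0<ε}} η {{ℚ.positive 0<η}}}})
  in M ℕ.⊔ N , λ n K≤n → ℚ.*-cancelʳ-<-nonNeg η {{ℚ.nonNegative (ℚ.<⇒≤ 0<η)}} (begin-strict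
    ℚ.∣ seq x n ℚ.- seq y n ∣ ℚ.* η
      ≤⟨ ℚ.*-monoˡ-≤-nonNeg ℚ.∣ seq x n ℚ.- seq y n ∣ {{ℚ.∣-∣-nonNeg (seq x n ℚ.- seq y n)}}
           (large n (ℕ.m⊔n≤o⇒m≤o M N K≤n)) ⟩
    ℚ.∣ seq x n ℚ.- seq y n ∣ ℚ.* ℚ.∣ seq s n ∣
      ≡⟨ ℚ.∣p*q∣≡∣p∣*∣q∣ (seq x n ℚ.- seq y n) (seq s n) ⟨
    ℚ.∣ (seq x n ℚ.- seq y n) ℚ.* seq s n ∣
      ≡⟨ cong ℚ.∣_∣ (solve 3 (λ x y s → (x :- y) :* s := x :* s :- y :* s) refl (seq x n) (seq y n) (seq s n)) ⟩
    ℚ.∣ seq x n ℚ.* seq s n ℚ.- seq y n ℚ.* seq s n ∣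
      <⟨ h n (ℕ.m⊔n≤o⇒n≤o M N K≤n) ⟩
    ε ℚ.* η ∎)
  where open ℚ.≤-Reasoning

square-sum-zero : ∀ {x y} → (∀ ε → 0ℚ ℚ.< ε → EventuallySmall ε (x *ℝ x +ℝ y *ℝ y)) → x ≈ℝ 0ℝ
square-sum-zero {x} {y} small ε 0<ε = let N , h = small (ε ℚ.* ε) (0<square 0<ε) in
  N , λ n N≤n → square-cancel-< _ ε (ℚ.<⇒≤ 0<ε) (begin-strict
    ℚ.∣ seq x n ℚ.- 0ℚ ∣ ℚ.* ℚ.∣ seq x n ℚ.- 0ℚ ∣
      ≡⟨ square-abs (seq x n ℚ.- 0ℚ) ⟩
    (seq x n ℚ.- 0ℚ) ℚ.* (seq x n ℚ.- 0ℚ)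
      ≡⟨ cong₂ ℚ._*_ (ℚ.+-identityʳ (seq x n)) (ℚ.+-identityʳ (seq x n)) ⟩
    seq x n ℚ.* seq x n                         ≡⟨ ℚ.+-identityʳ _ ⟨
    seq x n ℚ.* seq x n ℚ.+ 0ℚ                  ≤⟨ ℚ.+-monoʳ-≤ (seq x n ℚ.* seq x n) (0≤square (seq y n)) ⟩
    seq x n ℚ.* seq x n ℚ.+ seq y n ℚ.* seq y n
      ≡⟨ ℚ.0≤p⇒∣p∣≡p (ℚ.+-mono-≤ (0≤square (seq x n)) (0≤square (seq y n))) ⟨
    ℚ.∣ seq x n ℚ.* seq x n ℚ.+ seq y n ℚ.* seq y n ∣
      <⟨ h n N≤n ⟩
    ε ℚ.* ε ∎)
  where open ℚ.≤-Reasoning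

-- `√-approx` approximates from below, so its square is at most the absolute value of the term of
-- `x`, eventually less than `d² + (ε/2)²`. One half of `ε` absorbs this error; the other makes
-- `B² < (B + ε/2)²` strict, as `square-sum-<` requires.
√ℝ-bound : ∀ {x d B} → x ≈ℝ fromℚ (d ℚ.* d) → ℚ.∣ d ∣ ℚ.≤ B → √ℝ x ≤ℝ fromℚ B
√ℝ-bound {x} {d} {B} x≈dd ∣d∣≤B ε 0<ε =
  let N , h = x≈dd (ε ℚ.* ½ ℚ.* (ε ℚ.* ½)) (0<square (half-pos 0<ε))
  in N , λ n N≤n → square-cancel-< _ (B ℚ.+ ε) (ℚ.+-mono-≤ 0≤B (ℚ.<⇒≤ 0<ε)) (subst
    (λ z → √-approx n (seq x n) ℚ.* √-approx n (seq x n) ℚ.< z ℚ.* z)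
    (trans (ℚ.+-assoc B (ε ℚ.* ½) (ε ℚ.* ½)) (cong (B ℚ.+_) (half+half ε)))
    (square-sum-< _ (B ℚ.* B) ℚ.∣ seq x n ℚ.- d ℚ.* d ∣ (B ℚ.+ ε ℚ.* ½) (ε ℚ.* ½)
      (ℚ.+-mono-≤ 0≤B (ℚ.<⇒≤ (half-pos 0<ε))) (half-pos 0<ε)
      (ℚ.≤-trans (√-approx-lower n (seq x n)) (ℚ.≤-trans (abs-shift (seq x n) (d ℚ.* d))
        (ℚ.+-monoˡ-≤ ℚ.∣ seq x n ℚ.- d ℚ.* d ∣
          (subst (ℚ._≤ B ℚ.* B) (sym (ℚ.∣p*q∣≡∣p∣*∣q∣ d d)) (square-mono-≤ (ℚ.0≤∣p∣ d) ∣d∣≤B)))))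
      (square-mono-< 0≤B (subst (ℚ._< B ℚ.+ ε ℚ.* ½) (ℚ.+-identityʳ B) (ℚ.+-monoʳ-< B (half-pos 0<ε))))
      (h n N≤n)))
  where
  0≤B : 0ℚ ℚ.≤ B
  0≤B = ℚ.≤-trans (ℚ.0≤∣p∣ d) ∣d∣≤B

-- Complex arithmetic and finite complex sums.

≈ℂ-pointwise : ∀ {z w} → (∀ n → seq (re z) n ≡ seq (re w) n) → (∀ n → seq (im z) n ≡ seq (im w) n) → z ≈ℂ w
≈ℂ-pointwise {z} {w} re≡ im≡ = ≈ℝ-pointwise {re z} {re w} re≡ , ≈ℝ-pointwise {im z} {im w} im≡

≈ℂ-refl : ∀ {z} → z ≈ℂ z
≈ℂ-refl {z} = ≈ℝ-refl {re z} , ≈ℝ-refl {im z}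

≈ℂ-sym : ∀ {z w} → z ≈ℂ w → w ≈ℂ z
≈ℂ-sym {z} {w} (r , i) = ≈ℝ-sym {re z} {re w} r , ≈ℝ-sym {im z} {im w} i

≈ℂ-trans : ∀ {z w v} → z ≈ℂ w → w ≈ℂ v → z ≈ℂ v
≈ℂ-trans {z} {w} {v} (r , i) (r′ , i′) =
  ≈ℝ-trans {re z} {re w} {re v} r r′ , ≈ℝ-trans {im z} {im w} {im v} i i′

+ℂ-cong : ∀ {z z′ w w′} → z ≈ℂ z′ → w ≈ℂ w′ → z +ℂ w ≈ℂ z′ +ℂ w′
+ℂ-cong {z} {z′} {w} {w′} (r , i) (r′ , i′) =
  +ℝ-cong {re z} {re z′} {re w} {re w′} r r′ , +ℝ-cong {im z} {im z′} {im w} {im w′} i i′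

*ℂ-cong : ∀ {z z′ w w′} → z ≈ℂ z′ → w ≈ℂ w′ → z *ℂ w ≈ℂ z′ *ℂ w′
*ℂ-cong {z} {z′} {w} {w′} (r , i) (r′ , i′) =
    +ℝ-cong {re z *ℝ re w} {re z′ *ℝ re w′} { -ℝ (im z *ℝ im w)} { -ℝ (im z′ *ℝ im w′)}
      (*ℝ-cong {re z} {re z′} {re w} {re w′} r r′)
      (-ℝ-cong {im z *ℝ im w} {im z′ *ℝ im w′} (*ℝ-cong {im z} {im z′} {im w} {im w′} i i′))
  , +ℝ-cong {re z *ℝ im w} {re z′ *ℝ im w′} {im z *ℝ re w} {im z′ *ℝ re w′}
      (*ℝ-cong {re z} {re z′} {im w} {im w′} r i′)
      (*ℝ-cong {im z} {im z′} {re w} {re w′} i r′)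

*ℂ-assoc : ∀ z w v → (z *ℂ w) *ℂ v ≈ℂ z *ℂ (w *ℂ v)
*ℂ-assoc z w v = ≈ℂ-pointwise {(z *ℂ w) *ℂ v} {z *ℂ (w *ℂ v)}
  (λ n → solve 6 (λ a b c d e f →
     (a :* c :- b :* d) :* e :- (a :* d :+ b :* c) :* f := a :* (c :* e :- d :* f) :- b :* (c :* f :+ d :* e)) refl
     (seq (re z) n) (seq (im z) n) (seq (re w) n) (seq (im w) n) (seq (re v) n) (seq (im v) n))
  (λ n → solve 6 (λ a b c d e f →
     (a :* c :- b :* d) :* f :+ (a :* d :+ b :* c) :* e := a :* (c :* f :+ d :* e) :+ b :* (c :* e :- d :* f)) refl
     (seq (re z) n) (seq (im z) n) (seq (re w) n) (seq (im w) n) (seq (re v) n) (seq (im v) n))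

*ℂ-identityʳ : ∀ z → z *ℂ 1ℂ ≈ℂ z
*ℂ-identityʳ z = ≈ℂ-pointwise {z *ℂ 1ℂ} {z}
  (λ n → solve 2 (λ a b → a :* con 1ℚ :- b :* con 0ℚ := a) refl (seq (re z) n) (seq (im z) n))
  (λ n → solve 2 (λ a b → a :* con 0ℚ :+ b :* con 1ℚ := b) refl (seq (re z) n) (seq (im z) n))

*ℂ-zeroʳ : ∀ z → z *ℂ 0ℂ ≈ℂ 0ℂ
*ℂ-zeroʳ z = ≈ℂ-pointwise {z *ℂ 0ℂ} {0ℂ}
  (λ n → solve 2 (λ a b → a :* con 0ℚ :- b :* con 0ℚ := con 0ℚ) refl (seq (re z) n) (seq (im z) n))
  (λ n → solve 2 (λ a b → a :* con 0ℚ :+ b :* con 0ℚ := con 0ℚ) refl (seq (re z) n) (seq (im z) n))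

*ℂ-distribˡ : ∀ z w v → z *ℂ (w +ℂ v) ≈ℂ z *ℂ w +ℂ z *ℂ v
*ℂ-distribˡ z w v = ≈ℂ-pointwise {z *ℂ (w +ℂ v)} {z *ℂ w +ℂ z *ℂ v}
  (λ n → solve 6 (λ a b c d e f →
     a :* (c :+ e) :- b :* (d :+ f) := (a :* c :- b :* d) :+ (a :* e :- b :* f)) refl
     (seq (re z) n) (seq (im z) n) (seq (re w) n) (seq (im w) n) (seq (re v) n) (seq (im v) n))
  (λ n → solve 6 (λ a b c d e f →
     a :* (d :+ f) :+ b :* (c :+ e) := (a :* d :+ b :* c) :+ (a :* f :+ b :* e)) refl
     (seq (re z) n) (seq (im z) n) (seq (re w) n) (seq (im w) n) (seq (re v) n) (seq (im v) n))

sumℂ-map-cong : ∀ {A : Set} (f g : A → ℂ) → (∀ x → f x ≈ℂ g x) → ∀ xs → sumℂ (map f xs) ≈ℂ sumℂ (map g xs)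
sumℂ-map-cong f g f≈g []       = ≈ℂ-refl {0ℂ}
sumℂ-map-cong f g f≈g (x ∷ xs) =
  +ℂ-cong {f x} {g x} {sumℂ (map f xs)} {sumℂ (map g xs)} (f≈g x) (sumℂ-map-cong f g f≈g xs)

*ℂ-distribˡ-sum : ∀ {A : Set} z (f : A → ℂ) xs → z *ℂ sumℂ (map f xs) ≈ℂ sumℂ (map (λ x → z *ℂ f x) xs)
*ℂ-distribˡ-sum z f []       = *ℂ-zeroʳ z
*ℂ-distribˡ-sum z f (x ∷ xs) =
  ≈ℂ-trans {z *ℂ (f x +ℂ s)} {z *ℂ f x +ℂ z *ℂ s} {z *ℂ f x +ℂ t} (*ℂ-distribˡ z (f x) s)
    (+ℂ-cong {z *ℂ f x} {z *ℂ f x} {z *ℂ s} {t} (≈ℂ-refl {z *ℂ f x}) (*ℂ-distribˡ-sum z f xs))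
  where
  s = sumℂ (map f xs)
  t = sumℂ (map (λ x → z *ℂ f x) xs)

sumℂ-↭ : ∀ {xs ys} → xs ↭ ys → sumℂ xs ≈ℂ sumℂ ys
sumℂ-↭ {xs} ↭.refl = ≈ℂ-refl {sumℂ xs}
sumℂ-↭ (↭.prep {xs} {ys} z p) = +ℂ-cong {z} {z} {sumℂ xs} {sumℂ ys} (≈ℂ-refl {z}) (sumℂ-↭ p)
sumℂ-↭ (↭.swap {xs} {ys} z w p) =
  ≈ℂ-trans {z +ℂ (w +ℂ sumℂ xs)} {w +ℂ (z +ℂ sumℂ xs)} {w +ℂ (z +ℂ sumℂ ys)}
    (≈ℂ-pointwise {z +ℂ (w +ℂ sumℂ xs)} {w +ℂ (z +ℂ sumℂ xs)}
      (λ n → exchange (seq (re z) n) (seq (re w) n) (seq (re (sumℂ xs)) n))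
      (λ n → exchange (seq (im z) n) (seq (im w) n) (seq (im (sumℂ xs)) n)))
    (+ℂ-cong {w} {w} {z +ℂ sumℂ xs} {z +ℂ sumℂ ys} (≈ℂ-refl {w})
      (+ℂ-cong {z} {z} {sumℂ xs} {sumℂ ys} (≈ℂ-refl {z}) (sumℂ-↭ p)))
  where
  exchange : ∀ a b c → a ℚ.+ (b ℚ.+ c) ≡ b ℚ.+ (a ℚ.+ c)
  exchange = solve 3 (λ a b c → a :+ (b :+ c) := b :+ (a :+ c)) refl
sumℂ-↭ (↭.trans {xs} {ys} {zs} p r) = ≈ℂ-trans {sumℂ xs} {sumℂ ys} {sumℂ zs} (sumℂ-↭ p) (sumℂ-↭ r)

-- Opaque so that case splits do not normalise the gcd inside _/_.
opaque
  fromNat : ℕ → ℚ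
  fromNat k = ℤ.+ k ℚ./ 1

  fromNat-+ : ∀ m n → fromNat (m ℕ.+ n) ≡ fromNat m ℚ.+ fromNat n
  fromNat-+ m n = ℚ.toℚᵘ-injective (begin
    ℚ.toℚᵘ (fromNat (m ℕ.+ n))                  ≈⟨ ℚ.toℚᵘ-fromℚᵘ (ℚᵘ.mkℚᵘ (ℤ.+ (m ℕ.+ n)) 0) ⟩
    ℚᵘ.mkℚᵘ (ℤ.+ (m ℕ.+ n)) 0                      ≈⟨ ℚᵘ.*≡* (cong (ℤ._* ℤ.+ 1)
        (sym (cong₂ ℤ._+_ (ℤ.*-identityʳ (ℤ.+ m)) (ℤ.*-identityʳ (ℤ.+ n))))) ⟩
    ℚᵘ.mkℚᵘ (ℤ.+ m) 0 ℚᵘ.+ ℚᵘ.mkℚᵘ (ℤ.+ n) 0         ≈⟨ ℚᵘ.+-cong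
      (ℚ.toℚᵘ-fromℚᵘ (ℚᵘ.mkℚᵘ (ℤ.+ m) 0)) (ℚ.toℚᵘ-fromℚᵘ (ℚᵘ.mkℚᵘ (ℤ.+ n) 0)) ⟨
    ℚ.toℚᵘ (fromNat m) ℚᵘ.+ ℚ.toℚᵘ (fromNat n)  ≈⟨ ℚ.toℚᵘ-homo-+ (fromNat m) (fromNat n) ⟨
    ℚ.toℚᵘ (fromNat m ℚ.+ fromNat n)            ∎)
    where open ℚᵘ.≃-Reasoning

  fromNat-nonNeg : ∀ k → 0ℚ ℚ.≤ fromNat k
  fromNat-nonNeg k = ℚ.nonNegative⁻¹ (fromNat k) {{ℚ.normalize-nonNeg k 1}}

  fromℕ≡ : ∀ k → fromℕ k ≡ fromℚ (fromNat k)
  fromℕ≡ k = refl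

  fromNat-1 : fromNat 1 ≡ 1ℚ
  fromNat-1 = refl

  fromNat-0 : fromNat 0 ≡ 0ℚ
  fromNat-0 = refl

fromNat-mono-≤ : ∀ {m n} → m ≤ n → fromNat m ℚ.≤ fromNat n
fromNat-mono-≤ {m} {n} m≤n = subst₂ ℚ._≤_ (ℚ.+-identityʳ (fromNat m))
  (trans (sym (fromNat-+ m (n ∸ m))) (cong fromNat (ℕ.m+[n∸m]≡n m≤n)))
  (ℚ.+-monoʳ-≤ (fromNat m) (fromNat-nonNeg (n ∸ m)))

fromNat-difference-≤ : ∀ {m n b} → m ≤ n ℕ.+ b → fromNat m ℚ.- fromNat n ℚ.≤ fromNat b
fromNat-difference-≤ {m} {n} {b} m≤n+b = subst (fromNat m ℚ.- fromNat n ℚ.≤_)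
  (trans (cong (ℚ._- fromNat n) (fromNat-+ n b))
    (solve 2 (λ n b → (n :+ b) :- n := b) refl (fromNat n) (fromNat b)))
  (ℚ.+-monoˡ-≤ (ℚ.- fromNat n) (fromNat-mono-≤ m≤n+b))

∣fromNat-difference∣≤ : ∀ {m n b} → m ≤ n ℕ.+ b → n ≤ m ℕ.+ b → ℚ.∣ fromNat m ℚ.- fromNat n ∣ ℚ.≤ fromNat b
∣fromNat-difference∣≤ {m} {n} {b} m≤n+b n≤m+b with ℚ.∣p∣≡p∨∣p∣≡-p (fromNat m ℚ.- fromNat n)
... | inj₁ eq = subst (ℚ._≤ fromNat b) (sym eq) (fromNat-difference-≤ {m} {n} m≤n+b)
... | inj₂ eq = subst (ℚ._≤ fromNat b) (sym (trans eq (sym (neg-difference (fromNat m) (fromNat n)))))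
                  (fromNat-difference-≤ {n} {m} n≤m+b)

-- Rational sums grouped by the fibres of a map.

sumℚ : ∀ {A : Set} → (A → ℚ) → List A → ℚ
sumℚ f = foldr (λ x s → f x ℚ.+ s) 0ℚ

sumℚ-cong : ∀ {A : Set} {f g : A → ℚ} → (∀ x → f x ≡ g x) → ∀ xs → sumℚ f xs ≡ sumℚ g xs
sumℚ-cong f≡g []       = refl
sumℚ-cong f≡g (x ∷ xs) = cong₂ ℚ._+_ (f≡g x) (sumℚ-cong f≡g xs)

sumℚ-+ : ∀ {A : Set} (f g : A → ℚ) xs → sumℚ (λ x → f x ℚ.+ g x) xs ≡ sumℚ f xs ℚ.+ sumℚ g xs
sumℚ-+ f g []       = refl
sumℚ-+ f g (x ∷ xs) = trans (cong (f x ℚ.+ g x ℚ.+_) (sumℚ-+ f g xs))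
  (solve 4 (λ a b c d → (a :+ b) :+ (c :+ d) := (a :+ c) :+ (b :+ d)) refl (f x) (g x) (sumℚ f xs) (sumℚ g xs))

sumℚ-*ˡ : ∀ {A : Set} c (f : A → ℚ) xs → sumℚ (λ x → c ℚ.* f x) xs ≡ c ℚ.* sumℚ f xs
sumℚ-*ˡ c f []       = sym (ℚ.*-zeroʳ c)
sumℚ-*ˡ c f (x ∷ xs) = trans (cong (c ℚ.* f x ℚ.+_) (sumℚ-*ˡ c f xs)) (sym (ℚ.*-distribˡ-+ c (f x) (sumℚ f xs)))

sumℚ-zero : ∀ {A : Set} {f : A → ℚ} xs → (∀ {x} → x ∈ xs → f x ≡ 0ℚ) → sumℚ f xs ≡ 0ℚ
sumℚ-zero []       f≡0 = refl
sumℚ-zero (x ∷ xs) f≡0 = trans (cong₂ ℚ._+_ (f≡0 (here refl)) (sumℚ-zero xs (f≡0 ∘ there))) (ℚ.+-identityˡ 0ℚ)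

-- Gives access to the approximations of a complex sum at a fixed index, where regrouping is an
-- equality `≡` of rationals.
sumℂ-re : ∀ {A : Set} (f : A → ℂ) xs n → seq (re (sumℂ (map f xs))) n ≡ sumℚ (λ x → seq (re (f x)) n) xs
sumℂ-re f []       n = refl
sumℂ-re f (x ∷ xs) n = cong (seq (re (f x)) n ℚ.+_) (sumℂ-re f xs n)

sumℂ-im : ∀ {A : Set} (f : A → ℂ) xs n → seq (im (sumℂ (map f xs))) n ≡ sumℚ (λ x → seq (im (f x)) n) xs
sumℂ-im f []       n = refl
sumℂ-im f (x ∷ xs) n = cong (seq (im (f x)) n ℚ.+_) (sumℂ-im f xs n)

module Fibres {B : Set} (_≟_ : DecidableEquality B) where

  indicator : B → B → ℚ
  indicator b a with b ≟ a
  ... | yes _ = 1ℚ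
  ... | no  _ = 0ℚ

  indicator≡1 : ∀ b → indicator b b ≡ 1ℚ
  indicator≡1 b with b ≟ b
  ... | yes _   = refl
  ... | no  b≢b = contradiction refl b≢b

  indicator≡0 : ∀ {b a} → b ≢ a → indicator b a ≡ 0ℚ
  indicator≡0 {b} {a} b≢a with b ≟ a
  ... | yes b≡a = contradiction b≡a b≢a
  ... | no  _   = refl

  sumℚ-indicator : ∀ {E b} → Unique E → b ∈ E → (r : B → ℚ) → sumℚ (λ a → indicator b a ℚ.* r a) E ≡ r b
  sumℚ-indicator {a ∷ E} (a∉E ∷ _) (here refl) r = trans
    (cong₂ ℚ._+_ (trans (cong (ℚ._* r a) (indicator≡1 a)) (ℚ.*-identityˡ (r a)))
      (sumℚ-zero E λ {x} x∈E → trans (cong (ℚ._* r x) (indicator≡0 (All.lookup a∉E x∈E))) (ℚ.*-zeroˡ (r x))))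
    (ℚ.+-identityʳ (r a))
  sumℚ-indicator {a ∷ E} (a∉E ∷ uniq) (there b∈E) r = trans
    (cong₂ ℚ._+_
      (trans (cong (ℚ._* r a) (indicator≡0 (All.lookup a∉E b∈E ∘ sym))) (ℚ.*-zeroˡ (r a)))
      (sumℚ-indicator uniq b∈E r))
    (ℚ.+-identityˡ _)

  module _ {A : Set} (g : A → B) where

    multiplicity : List A → B → ℕ
    multiplicity L a = length (filter (λ x → g x ≟ a) L)

    multiplicity-∷ : ∀ x L a → fromNat (multiplicity (x ∷ L) a) ≡ indicator (g x) a ℚ.+ fromNat (multiplicity L a)
    multiplicity-∷ x L a with g x ≟ a
    ... | yes _ = trans (fromNat-+ 1 (multiplicity L a)) (cong (ℚ._+ fromNat (multiplicity L a)) fromNat-1)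
    ... | no  _ = sym (ℚ.+-identityˡ _)

    -- Induction on `L` with `E` fixed: a new `x` raises exactly one multiplicity, the one over
    -- `g x`, and the indicator sum picks out `r (g x)`.
    sumℚ-fibres : ∀ {E} → Unique E → (∀ b → b ∈ E) → (r : B → ℚ) → ∀ L →
      sumℚ (λ x → r (g x)) L ≡ sumℚ (λ a → fromNat (multiplicity L a) ℚ.* r a) E
    sumℚ-fibres {E} uniq all∈E r []      = sym (sumℚ-zero E λ {a} _ → trans (cong (ℚ._* r a) fromNat-0) (ℚ.*-zeroˡ (r a)))
    sumℚ-fibres {E} uniq all∈E r (x ∷ L) = sym (begin
      sumℚ (λ a → fromNat (multiplicity (x ∷ L) a) ℚ.* r a) E
        ≡⟨ sumℚ-cong (λ a → trans (cong (ℚ._* r a) (multiplicity-∷ x L a))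
             (ℚ.*-distribʳ-+ (r a) (indicator (g x) a) (fromNat (multiplicity L a)))) E ⟩
      sumℚ (λ a → indicator (g x) a ℚ.* r a ℚ.+ fromNat (multiplicity L a) ℚ.* r a) E
        ≡⟨ sumℚ-+ (λ a → indicator (g x) a ℚ.* r a) (λ a → fromNat (multiplicity L a) ℚ.* r a) E ⟩
      sumℚ (λ a → indicator (g x) a ℚ.* r a) E ℚ.+ sumℚ (λ a → fromNat (multiplicity L a) ℚ.* r a) E
        ≡⟨ cong₂ ℚ._+_ (sumℚ-indicator uniq (all∈E (g x)) r) (sym (sumℚ-fibres uniq all∈E r L)) ⟩
      r (g x) ℚ.+ sumℚ (λ x → r (g x)) L ∎)
      where open ≡-Reasoning

    -- Taking the weight `k` off every fibre leaves weight only over `b`; what was taken off is `k`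
    -- times the full sum of `r`. For characters `b` is `0#`, and the full sum tends to zero.
    sumℚ-two-values : ∀ {E} → Unique E → (∀ b → b ∈ E) → (r : B → ℚ) → ∀ L (b : B) (k : ℕ) →
      (∀ {a} → a ≢ b → multiplicity L a ≡ k) →
      sumℚ (λ x → r (g x)) L ≡ (fromNat (multiplicity L b) ℚ.- fromNat k) ℚ.* r b ℚ.+ fromNat k ℚ.* sumℚ r E
    sumℚ-two-values {E} uniq all∈E r L b k const = begin
      sumℚ (λ x → r (g x)) L
        ≡⟨ sumℚ-fibres uniq all∈E r L ⟩
      sumℚ (λ a → fromNat (multiplicity L a) ℚ.* r a) E
        ≡⟨ sumℚ-cong term E ⟩
      sumℚ (λ a → D ℚ.* (indicator b a ℚ.* r a) ℚ.+ fromNat k ℚ.* r a) E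
        ≡⟨ sumℚ-+ (λ a → D ℚ.* (indicator b a ℚ.* r a)) (λ a → fromNat k ℚ.* r a) E ⟩
      sumℚ (λ a → D ℚ.* (indicator b a ℚ.* r a)) E ℚ.+ sumℚ (λ a → fromNat k ℚ.* r a) E
        ≡⟨ cong₂ ℚ._+_
             (trans (sumℚ-*ˡ D (λ a → indicator b a ℚ.* r a) E) (cong (D ℚ.*_) (sumℚ-indicator uniq (all∈E b) r)))
             (sumℚ-*ˡ (fromNat k) r E) ⟩
      D ℚ.* r b ℚ.+ fromNat k ℚ.* sumℚ r E ∎
      where
      open ≡-Reasoning
      D = fromNat (multiplicity L b) ℚ.- fromNat k
      term : ∀ a → fromNat (multiplicity L a) ℚ.* r a ≡ D ℚ.* (indicator b a ℚ.* r a) ℚ.+ fromNat k ℚ.* r a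
      term a with b ≟ a
      ... | yes refl = solve 3 (λ m k r → m :* r := (m :- k) :* (con 1ℚ :* r) :+ k :* r) refl
                         (fromNat (multiplicity L b)) (fromNat k) (r b)
      ... | no  b≢a  = trans (cong (λ m → fromNat m ℚ.* r a) (const (b≢a ∘ sym)))
                         (solve 3 (λ m k r → k :* r := (m :- k) :* (con 0ℚ :* r) :+ k :* r) refl
                           (fromNat (multiplicity L b)) (fromNat k) (r a))

-- From rational approximations to complex numbers and their absolute values.

-- The limit of the formula for the Gauss sum: `x` is the real or imaginary part of `⟦ 0# ⟧`, with
-- limit `c`, and `y` that of the vanishing character sum.
combination-≈ : ∀ d k {x y} c → x ≈ℝ fromℚ c → y ≈ℝ 0ℝ → fromℚ d *ℝ x +ℝ fromℚ k *ℝ y ≈ℝ fromℚ (d ℚ.* c)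
combination-≈ d k {x} {y} c x≈c y≈0 =
  ≈ℝ-trans {fromℚ d *ℝ x +ℝ fromℚ k *ℝ y} {fromℚ d *ℝ fromℚ c +ℝ fromℚ k *ℝ 0ℝ} {fromℚ (d ℚ.* c)}
    (+ℝ-cong {fromℚ d *ℝ x} {fromℚ d *ℝ fromℚ c} {fromℚ k *ℝ y} {fromℚ k *ℝ 0ℝ}
      (*ℝ-cong {fromℚ d} {fromℚ d} {x} {fromℚ c} (≈ℝ-refl {fromℚ d}) x≈c)
      (*ℝ-cong {fromℚ k} {fromℚ k} {y} {0ℝ} (≈ℝ-refl {fromℚ k}) y≈0))
    (≈ℝ-pointwise {fromℚ d *ℝ fromℚ c +ℝ fromℚ k *ℝ 0ℝ} {fromℚ (d ℚ.* c)} λ _ →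
      solve 3 (λ d c k → d :* c :+ k :* con 0ℚ := d :* c) refl d c k)

∣real∣ℂ≤ : ∀ {z d B} → re z ≈ℝ fromℚ d → im z ≈ℝ 0ℝ → ℚ.∣ d ∣ ℚ.≤ B → ∣ z ∣ℂ ≤ℝ fromℚ B
∣real∣ℂ≤ {z} {d} {B} re≈d im≈0 = √ℝ-bound {re z *ℝ re z +ℝ im z *ℝ im z} {d} {B}
  (≈ℝ-trans {re z *ℝ re z +ℝ im z *ℝ im z} {fromℚ d *ℝ fromℚ d +ℝ 0ℝ *ℝ 0ℝ} {fromℚ (d ℚ.* d)}
    (+ℝ-cong {re z *ℝ re z} {fromℚ d *ℝ fromℚ d} {im z *ℝ im z} {0ℝ *ℝ 0ℝ}
      (*ℝ-cong {re z} {fromℚ d} {re z} {fromℚ d} re≈d re≈d) (*ℝ-cong {im z} {0ℝ} {im z} {0ℝ} im≈0 im≈0))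
    (≈ℝ-pointwise {fromℚ d *ℝ fromℚ d +ℝ 0ℝ *ℝ 0ℝ} {fromℚ (d ℚ.* d)} λ _ →
      solve 1 (λ d → d :* d :+ con 0ℚ :* con 0ℚ := d :* d) refl d))

norm² : ℂ → ℝ
norm² z = re z *ℝ re z +ℝ im z *ℝ im z

-- Multiplying z s ≈ s by the conjugate of s.
fixes⇒fixes-norm² : ∀ {z s} → z *ℂ s ≈ℂ s →
  re z *ℝ norm² s ≈ℝ 1ℝ *ℝ norm² s × im z *ℝ norm² s ≈ℝ 0ℝ *ℝ norm² s
fixes⇒fixes-norm² {z} {s} (zs≈s-re , zs≈s-im) =
    ≈ℝ-trans {re z *ℝ norm² s} {re w *ℝ re s +ℝ im w *ℝ im s} {1ℝ *ℝ norm² s}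
      (≈ℝ-pointwise {re z *ℝ norm² s} {re w *ℝ re s +ℝ im w *ℝ im s} λ n →
        solve 4 (λ a b s t → a :* (s :* s :+ t :* t) := (a :* s :- b :* t) :* s :+ (a :* t :+ b :* s) :* t) refl
          (seq (re z) n) (seq (im z) n) (seq (re s) n) (seq (im s) n))
      (≈ℝ-trans {re w *ℝ re s +ℝ im w *ℝ im s} {norm² s} {1ℝ *ℝ norm² s}
        (+ℝ-cong {re w *ℝ re s} {re s *ℝ re s} {im w *ℝ im s} {im s *ℝ im s}
          (*ℝ-cong {re w} {re s} {re s} {re s} zs≈s-re (≈ℝ-refl {re s}))
          (*ℝ-cong {im w} {im s} {im s} {im s} zs≈s-im (≈ℝ-refl {im s})))
        (≈ℝ-pointwise {norm² s} {1ℝ *ℝ norm² s} λ n → sym (ℚ.*-identityˡ (seq (norm² s) n))))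
  , ≈ℝ-trans {im z *ℝ norm² s} {im w *ℝ re s -ℝ re w *ℝ im s} {0ℝ *ℝ norm² s}
      (≈ℝ-pointwise {im z *ℝ norm² s} {im w *ℝ re s -ℝ re w *ℝ im s} λ n →
        solve 4 (λ a b s t → b :* (s :* s :+ t :* t) := (a :* t :+ b :* s) :* s :- (a :* s :- b :* t) :* t) refl
          (seq (re z) n) (seq (im z) n) (seq (re s) n) (seq (im s) n))
      (≈ℝ-trans {im w *ℝ re s -ℝ re w *ℝ im s} {im s *ℝ re s -ℝ re s *ℝ im s} {0ℝ *ℝ norm² s}
        (+ℝ-cong {im w *ℝ re s} {im s *ℝ re s} { -ℝ (re w *ℝ im s)} { -ℝ (re s *ℝ im s)}
          (*ℝ-cong {im w} {im s} {re s} {re s} zs≈s-im (≈ℝ-refl {re s}))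
          (-ℝ-cong {re w *ℝ im s} {re s *ℝ im s} (*ℝ-cong {re w} {re s} {im s} {im s} zs≈s-re (≈ℝ-refl {im s}))))
        (≈ℝ-pointwise {im s *ℝ re s -ℝ re s *ℝ im s} {0ℝ *ℝ norm² s} λ n →
          solve 2 (λ s t → t :* s :- s :* t := con 0ℚ :* (s :* s :+ t :* t)) refl (seq (re s) n) (seq (im s) n)))
  where
  w = z *ℂ s

-- If `norm² s` were bounded away from zero, it could be cancelled for every `a`, giving `f a ≈ℂ 1ℂ`
-- throughout. This refutes the second case of `small-or-large` for each `ε`, and no `a` with `f a`
-- different from `1ℂ` has to be exhibited.
unfixed⇒≈0 : ∀ {A : Set} (f : A → ℂ) s → (∀ a → f a *ℂ s ≈ℂ s) → ¬ (∀ a → f a ≈ℂ 1ℂ) → s ≈ℂ 0ℂ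
unfixed⇒≈0 f s fixes nontrivial =
    square-sum-zero {re s} {im s} small
  , square-sum-zero {im s} {re s} λ ε 0<ε → let N , h = small ε 0<ε in
      N , λ n N≤n → subst (λ p → ℚ.∣ p ∣ ℚ.< ε)
        (ℚ.+-comm (seq (re s) n ℚ.* seq (re s) n) (seq (im s) n ℚ.* seq (im s) n)) (h n N≤n)
  where
  small : ∀ ε → 0ℚ ℚ.< ε → EventuallySmall ε (norm² s)
  small ε 0<ε = fromInj₁ (λ (η , 0<η , large) → contradiction
      (λ a → let r , i = fixes⇒fixes-norm² {f a} {s} (fixes a) in
          *ℝ-cancelʳ {re (f a)} {1ℝ} {norm² s} 0<η large r
        , *ℝ-cancelʳ {im (f a)} {0ℝ} {norm² s} 0<η large i)
      nontrivial)
    (small-or-large (norm² s) 0<ε)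

-- Additive characters and the Gauss sum.

module Characters {q : ℕ} (F : FiniteField q) (χ : AdditiveCharacter F) where
  open FiniteField F
  open Counting F
  open AdditiveCharacter χ
  open CommutativeRing commutativeRing using (+-assoc; +-identityˡ; +-identityʳ; -‿inverseʳ; -‿inverseˡ)

  -- By `homo`, `z = ⟦ 0# ⟧` satisfies `z z ≈ z`; the inverse from `unit` cancels one factor.
  χ[0]≈1 : ⟦ 0# ⟧ ≈ℂ 1ℂ
  χ[0]≈1 = let w , zw≈1 = unit 0# in
    ≈ℂ-trans {z} {z *ℂ 1ℂ} {1ℂ} (≈ℂ-sym {z *ℂ 1ℂ} {z} (*ℂ-identityʳ z))
    (≈ℂ-trans {z *ℂ 1ℂ} {z *ℂ (z *ℂ w)} {1ℂ}
      (*ℂ-cong {z} {z} {1ℂ} {z *ℂ w} (≈ℂ-refl {z}) (≈ℂ-sym {z *ℂ w} {1ℂ} zw≈1))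
    (≈ℂ-trans {z *ℂ (z *ℂ w)} {(z *ℂ z) *ℂ w} {1ℂ}
      (≈ℂ-sym {(z *ℂ z) *ℂ w} {z *ℂ (z *ℂ w)} (*ℂ-assoc z z w))
    (≈ℂ-trans {(z *ℂ z) *ℂ w} {z *ℂ w} {1ℂ}
      (*ℂ-cong {z *ℂ z} {z} {w} {w}
        (subst (λ x → z *ℂ z ≈ℂ ⟦ x ⟧) (+-identityʳ 0#) (≈ℂ-sym {⟦ 0# + 0# ⟧} {z *ℂ z} (homo 0# 0#)))
        (≈ℂ-refl {w}))
      zw≈1)))
    where
    z = ⟦ 0# ⟧

  S : ℂ
  S = sumℂ (map ⟦_⟧ elements)

  -- Two duplicate-free lists with the same members are permutations of each other, and translation
  -- by `- b` shows that nothing is missed.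
  translation-↭ : ∀ b → map (b +_) elements ↭ elements
  translation-↭ b = ∼bag⇒↭ (unique∧set⇒bag
    (Unique.map⁺ (λ {x} {y} eq → trans (sym (undo x)) (trans (cong (- b +_) eq) (undo y))) elements-unique)
    elements-unique
    (λ {x} → mk⇔ (λ _ → ∈-elements x)
      (λ _ → subst (_∈ map (b +_) elements) (redo x) (∈-map⁺ (b +_) (∈-elements (- b + x))))))
    where
    undo : ∀ x → - b + (b + x) ≡ x
    undo x = trans (sym (+-assoc (- b) b x)) (trans (cong (_+ x) (-‿inverseˡ b)) (+-identityˡ x))
    redo : ∀ x → b + (- b + x) ≡ x
    redo x = trans (sym (+-assoc b (- b) x)) (trans (cong (_+ x) (-‿inverseʳ b)) (+-identityˡ x))

  -- Multiplying by `⟦ b ⟧` translates the summation variable by `b`, which only reorders the sum.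
  χ*S≈S : ∀ b → ⟦ b ⟧ *ℂ S ≈ℂ S
  χ*S≈S b =
    ≈ℂ-trans {⟦ b ⟧ *ℂ S} {sumℂ (map (λ x → ⟦ b ⟧ *ℂ ⟦ x ⟧) elements)} {S}
      (*ℂ-distribˡ-sum ⟦ b ⟧ ⟦_⟧ elements)
    (≈ℂ-trans {sumℂ (map (λ x → ⟦ b ⟧ *ℂ ⟦ x ⟧) elements)} {sumℂ (map (λ x → ⟦ b + x ⟧) elements)} {S}
      (sumℂ-map-cong (λ x → ⟦ b ⟧ *ℂ ⟦ x ⟧) (λ x → ⟦ b + x ⟧)
        (λ x → ≈ℂ-sym {⟦ b + x ⟧} {⟦ b ⟧ *ℂ ⟦ x ⟧} (homo b x)) elements)
      (subst (λ xs → sumℂ xs ≈ℂ S) (sym (map-∘ elements)) (sumℂ-↭ (↭.map⁺ ⟦_⟧ (translation-↭ b)))))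

  S≈0 : Nontrivial F χ → S ≈ℂ 0ℂ
  S≈0 nontrivial = unfixed⇒≈0 ⟦_⟧ S χ*S≈S nontrivial

  module _ {n : ℕ} (U : Matrix F n) (nontrivial : Nontrivial F χ) where
    open Fibres _≟_

    N₀ N₁ : ℕ
    N₀ = length (level U 0#)
    N₁ = length (level U 1#)

    D : ℚ
    D = fromNat N₀ ℚ.- fromNat N₁

    sum-over-GL : (r : Carrier → ℚ) →
      sumℚ (λ X → r (_·_ F U X)) (GL F n) ≡ D ℚ.* r 0# ℚ.+ fromNat N₁ ℚ.* sumℚ r elements
    sum-over-GL r = sumℚ-two-values (_·_ F U) elements-unique ∈-elements r (GL F n) 0# N₁ (length-level U)

    gaussSum≈D : re (gaussSum F U χ) ≈ℝ fromℚ D × im (gaussSum F U χ) ≈ℝ 0ℝ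
    gaussSum≈D =
        -- The limit is `D` times `⟦ 0# ⟧`, that is `D * 1` here and `D * 0` for the imaginary part.
        subst (λ d → re G ≈ℝ fromℚ d) (ℚ.*-identityʳ D)
          (≈ℝ-trans {re G} {fromℚ D *ℝ re ⟦ 0# ⟧ +ℝ fromℚ (fromNat N₁) *ℝ re S} {fromℚ (D ℚ.* 1ℚ)}
            (≈ℝ-pointwise {re G} {fromℚ D *ℝ re ⟦ 0# ⟧ +ℝ fromℚ (fromNat N₁) *ℝ re S} λ l →
              trans (sumℂ-re (λ X → ⟦ _·_ F U X ⟧) (GL F n) l) (trans (sum-over-GL (λ a → seq (re ⟦ a ⟧) l))
                (cong (λ s → D ℚ.* seq (re ⟦ 0# ⟧) l ℚ.+ fromNat N₁ ℚ.* s) (sym (sumℂ-re ⟦_⟧ elements l)))))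
            (combination-≈ D (fromNat N₁) {re ⟦ 0# ⟧} {re S} 1ℚ (proj₁ χ[0]≈1) (proj₁ (S≈0 nontrivial))))
      , subst (λ d → im G ≈ℝ fromℚ d) (ℚ.*-zeroʳ D)
          (≈ℝ-trans {im G} {fromℚ D *ℝ im ⟦ 0# ⟧ +ℝ fromℚ (fromNat N₁) *ℝ im S} {fromℚ (D ℚ.* 0ℚ)}
            (≈ℝ-pointwise {im G} {fromℚ D *ℝ im ⟦ 0# ⟧ +ℝ fromℚ (fromNat N₁) *ℝ im S} λ l →
              trans (sumℂ-im (λ X → ⟦ _·_ F U X ⟧) (GL F n) l) (trans (sum-over-GL (λ a → seq (im ⟦ a ⟧) l))
                (cong (λ s → D ℚ.* seq (im ⟦ 0# ⟧) l ℚ.+ fromNat N₁ ℚ.* s) (sym (sumℂ-im ⟦_⟧ elements l)))))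
            (combination-≈ D (fromNat N₁) {im ⟦ 0# ⟧} {im S} 0ℚ (proj₂ χ[0]≈1) (proj₂ (S≈0 nontrivial))))
      where G = gaussSum F U χ

    ∣gaussSum∣≤ : ∀ {B} → N₀ ≤ N₁ ℕ.+ B → N₁ ≤ N₀ ℕ.+ B → ∣ gaussSum F U χ ∣ℂ ≤ℝ fromℕ B
    ∣gaussSum∣≤ {B} N₀≤ N₁≤ = subst (∣ gaussSum F U χ ∣ℂ ≤ℝ_) (sym (fromℕ≡ B))
      (∣real∣ℂ≤ {gaussSum F U χ} {D} (proj₁ gaussSum≈D) (proj₂ gaussSum≈D) (∣fromNat-difference∣≤ {N₀} {N₁} N₀≤ N₁≤))

open import Data.Nat using (_*_)

corollary2p2 : ∀ (n : ℕ) → 1 ≤ n →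
    ∃ λ (C : ℝ) → 0ℝ <ℝ C ×
    (∀ (q : ℕ) (F : FiniteField q) (U : Matrix F n) → U ≢ 0ᴹ F →
    ∀ (χ : AdditiveCharacter F) → Nontrivial F χ →
    ∣ gaussSum F U χ ∣ℂ ≤ℝ C *ℝ fromℕ (q ^ (n * n ∸ n)))
-- The constant is `1`. The gap `½` witnesses its positivity: `<ℝ` asks for a strict inequality
-- after the gap is added, which a gap of `1` would not give.
corollary2p2 (suc m) _ = 1ℝ , (½ , ℚ.positive⁻¹ ½ , 0 , λ _ _ → toWitness {a? = 0ℚ ℚ.+ ½ ℚ.<? 1ℚ} _) ,
  λ q F U U≢0 χ nontrivial ε 0<ε →
    let open Counting F
        open FiniteField F using (0#; 1#)
        i , k , Uik≢0 = nonzero-entry U≢0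
        B = q ^ (suc m * suc m ∸ suc m)
        N , h = Characters.∣gaussSum∣≤ F χ U nontrivial {B}
          (level-close U i k Uik≢0 0# 1#) (level-close U i k Uik≢0 1# 0#) ε 0<ε
    in N , λ n N≤n → subst (λ b → seq ∣ gaussSum F U χ ∣ℂ n ℚ.< b ℚ.+ ε)
      (sym (ℚ.*-identityˡ (seq (fromℕ B) n))) (h n N≤n)
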